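{- Let $n\ge 2k\ge 4$. Let $\mathbb{S}$ be a $q$-covering design $\mathcal{C}_2(n-k+1,k,2)$ (a set of $k$-dimensional subspaces of $\mathbb{F}_2^{n-k+1}$ covering every $2$-dimensional subspace), let $U\subseteq\mathbb{F}_2^{n-k+1}$ be an $(n-k)$-dimensional subspace, and let $c=|\{X\in\mathbb{S}: X\subseteq U\}|$. Then $$\mathcal{C}_2(n,k,2)\le 2^{2(n-k)}+(2^k-1)|\mathbb{S}|-(2^k-2)c.$$
   Context: A $q$-covering design $\mathcal{C}_q(n,k,r)$ is a collection of $k$-dimensional subspaces of $\mathbb{F}_q^n$ such that every $r$-dimensional subspace of $\mathbb{F}_q^n$ is contained in at least one member; $\mathcal{C}_q(n,k,r)$ denotes the minimum size of such a collection. -}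

module Defs where

open import Data.Bool using (Bool; true; false; T; _∧_; _xor_)
open import Data.Bool.Properties using (T?)
open import Data.List using (List; length; filter)
open import Data.List.Relation.Unary.All using (All)
open import Data.List.Relation.Unary.Any using (Any)
import Data.List.Relation.Unary.Unique.Setoid as UniqueSetoid
open import Data.Nat using (ℕ; zero; suc; _≤_)
open import Data.Product using (Σ-syntax; ∃-syntax; _×_; _,_)
open import Data.Vec using (Vec; []; _∷_; map; zipWith; foldr′; replicate)
open import Data.Vec.Relation.Unary.All using () renaming (All to Allᵛ)
open import Level using (0ℓ)
open import Relation.Binary.Bundles using (Setoid)
open import Relation.Binary.PropositionalEquality using (_≡_)
open import Relation.Nullary using (Dec)
open import Relation.Nullary.Decidable using (map′; _×-dec_; _→-dec_)
open import Relation.Unary using (Pred; Decidable)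

-- The field with two elements: addition is _xor_, multiplication is _∧_
-- (cf. xor-∧-commutativeRing in Data.Bool.Properties).
𝔽₂ : Set
𝔽₂ = Bool

𝔽₂^_ : ℕ → Set
𝔽₂^ n = Vec 𝔽₂ n

infixl 6 _⊕_
infixr 7 _·_

𝟎 : ∀ {n} → 𝔽₂^ n
𝟎 = replicate _ false

_⊕_ : ∀ {n} → 𝔽₂^ n → 𝔽₂^ n → 𝔽₂^ n
_⊕_ = zipWith _xor_

_·_ : ∀ {n} → 𝔽₂ → 𝔽₂^ n → 𝔽₂^ n
a · v = map (a ∧_) v

linComb : ∀ {n d} → 𝔽₂^ d → Vec (𝔽₂^ n) d → 𝔽₂^ n
linComb as vs = foldr′ _⊕_ 𝟎 (zipWith _·_ as vs)

-- Subspaces are given by their characteristic functions. Since 𝔽₂^ n is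
-- finite, asking for decidable membership loses no generality.
record Subspace (n : ℕ) : Set where
  field
    χ        : 𝔽₂^ n → Bool
    𝟎-closed : T (χ 𝟎)
    ⊕-closed : ∀ {v w} → T (χ v) → T (χ w) → T (χ (v ⊕ w))
    ·-closed : ∀ a {v} → T (χ v) → T (χ (a · v))

infix 4 _∈_ _⊆_ _≐_ _⊆?_

_∈_ : ∀ {n} → 𝔽₂^ n → Subspace n → Set
v ∈ X = T (Subspace.χ X v)

_⊆_ : ∀ {n} → Subspace n → Subspace n → Set
X ⊆ Y = ∀ v → v ∈ X → v ∈ Y

_≐_ : ∀ {n} → Subspace n → Subspace n → Set
X ≐ Y = X ⊆ Y × Y ⊆ X

subspaceSetoid : ℕ → Setoid 0ℓ 0ℓ
subspaceSetoid n = record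
  { Carrier       = Subspace n
  ; _≈_           = _≐_
  ; isEquivalence = record
    { refl  = (λ _ p → p) , (λ _ p → p)
    ; sym   = λ (p , q) → q , p
    ; trans = λ (p , q) (p′ , q′) →
        (λ v x → p′ v (p v x)) , (λ v x → q v (q′ v x))
    }
  }

∀-dec : ∀ {n} {P : Pred (𝔽₂^ n) 0ℓ} → Decidable P → Dec (∀ v → P v)
∀-dec {zero}  P? = map′ (λ { p [] → p }) (λ f → f []) (P? [])
∀-dec {suc n} P? = map′
  (λ { (f , t) (false ∷ v) → f v ; (f , t) (true ∷ v) → t v })
  (λ h → (λ v → h (false ∷ v)) , (λ v → h (true ∷ v)))
  (∀-dec (λ v → P? (false ∷ v)) ×-dec ∀-dec (λ v → P? (true ∷ v)))

_⊆?_ : ∀ {n} (X Y : Subspace n) → Dec (X ⊆ Y)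
X ⊆? Y = ∀-dec (λ v → T? (Subspace.χ X v) →-dec T? (Subspace.χ Y v))

LinearlyIndependent : ∀ {n d} → Vec (𝔽₂^ n) d → Set
LinearlyIndependent vs = ∀ as → linComb as vs ≡ 𝟎 → as ≡ 𝟎

Spans : ∀ {n d} → Vec (𝔽₂^ n) d → Subspace n → Set
Spans vs X = ∀ v → v ∈ X → ∃[ as ] linComb as vs ≡ v

record IsBasis {n d} (vs : Vec (𝔽₂^ n) d) (X : Subspace n) : Set where
  field
    members     : Allᵛ (_∈ X) vs
    independent : LinearlyIndependent vs
    spanning    : Spans vs X

HasDim : ∀ {n} → Subspace n → ℕ → Set
HasDim {n} X d = Σ[ vs ∈ Vec (𝔽₂^ n) d ] IsBasis vs X

-- A set of subspaces is a list without repetitions up to _≐_, so its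
-- cardinality is the length of the list.
record CoveringDesign (n k r : ℕ) : Set where
  field
    blocks   : List (Subspace n)
    distinct : UniqueSetoid.Unique (subspaceSetoid n) blocks
    dims     : All (λ X → HasDim X k) blocks
    covers   : ∀ Y → HasDim Y r → Any (Y ⊆_) blocks

open CoveringDesign public

∣_∣ : ∀ {n k r} → CoveringDesign n k r → ℕ
∣ 𝕊 ∣ = length (blocks 𝕊)

blocksInside : ∀ {n k r} → CoveringDesign n k r → Subspace n → ℕ
blocksInside 𝕊 U = length (filter (_⊆? U) (blocks 𝕊))

-- m is the number 𝒞₂(n,k,r), the minimum size of a covering design.
IsCoveringNumber : (n k r m : ℕ) → Set
IsCoveringNumber n k r m =
  (Σ[ 𝕊 ∈ CoveringDesign n k r ] ∣ 𝕊 ∣ ≡ m) ×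
  (∀ (𝕊 : CoveringDesign n k r) → m ≤ ∣ 𝕊 ∣)

{-# OPTIONS --safe #-}

-- Write 𝔽₂ⁿ = 𝔽₂ᵏ × 𝔽₂ᵐ with m = n - k. A pair of vectors whose projections to 𝔽₂ᵏ are
-- independent lies in the graph of one of the 2²ᵐ maps u ↦ a u + b u², where 𝔽₂ᵏ sits inside
-- the field with 2ᵐ elements: such a map takes prescribed values at two independent points
-- (this is the lifted Gabidulin code). Every other pair lies in ⟨ u ⟩ × 𝔽₂ᵐ for some u ≠ 0,
-- where a copy of 𝕊 that identifies U with 0 × 𝔽₂ᵐ covers it; the copies of the blocks
-- inside U do not depend on u, so each of them is needed only once.
--
-- The field is found as a quotient of R = 𝔽₂[x] / (x ^ (2ᵐ - 1) - 1). Every r in R satisfies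
-- r ^ 2ᵐ = r, so every nonzero element of R is invertible in some field quotient. The product
-- of all x ^ 2ᵈ - x with 0 < d < m has degree 2ᵐ - 2, hence is nonzero in R; in a field K
-- where it survives, x has m distinct conjugates, so 1, x, …, x ^ (m - 1) are independent,
-- while K has at most 2ᵐ elements, being made of roots of y ^ 2ᵐ - y.
module Submission where

open import Algebra.Bundles using (CommutativeRing)
import Algebra.Properties.Ring as Ringₚ
import Algebra.Solver.Ring.NaturalCoefficients.Default as RingSolver
open import Data.Bool using (Bool; true; false; _xor_)
import Data.Bool.Properties as Boolₚ
open import Data.Empty using (⊥-elim)
open import Data.Fin using (zero; suc)
import Data.Fin.Properties as Finₚ
open import Data.List using (List; []; _∷_; length; map; _++_; _∷ʳ_; lookup; filter; deduplicate; replicate; applyUpTo; cartesianProductWith)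
open import Data.List.Membership.Propositional using (lose) renaming (_∈_ to _∈ˡ_)
import Data.List.Membership.Propositional.Properties as ∈ₚ
import Data.List.Properties as Listₚ
open import Data.List.Relation.Unary.All as All using (All; []; _∷_)
import Data.List.Relation.Unary.All.Properties as Allₚ
open import Data.List.Relation.Unary.AllPairs as AllPairs using (AllPairs; []; _∷_)
import Data.List.Relation.Unary.AllPairs.Properties as AllPairsₚ
open import Data.List.Relation.Unary.Any as Any using (Any; here; there)
import Data.List.Relation.Unary.Any.Properties as Anyₚ
import Data.List.Relation.Unary.Unique.DecSetoid.Properties as Uniqueₚ
open import Data.Nat as ℕ using (ℕ; zero; suc; _≤_; _<_; z≤n; s≤s)
import Data.Nat.Properties as ℕₚ
open import Data.Nat.Solver using (module +-*-Solver)
open import Data.Product using (∃-syntax; _×_; _,_; proj₁; proj₂)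
open import Data.Sum using (_⊎_; inj₁; inj₂; [_,_]′)
open import Data.Unit using (⊤; tt)
open import Data.Vec as Vec using (Vec; []; _∷_; toList; fromList)
import Data.Vec.Properties as Vecₚ
open import Data.Vec.Relation.Unary.All as Allᵛ using ([]; _∷_) renaming (All to Allᵛ)
open import Function using (_∘_)
open import Level using (0ℓ)
open import Relation.Binary.Bundles using (Setoid; DecSetoid)
open import Relation.Binary.PropositionalEquality as ≡ using (_≡_; _≢_)
import Relation.Binary.Reasoning.Setoid as SetoidReasoning
open import Relation.Nullary using (¬_; Dec; yes; no)
open import Relation.Nullary.Decidable using (map′; _⊎-dec_; _×-dec_; _→-dec_; ¬?; ⌊_⌋; toWitness; fromWitness; decidable-stable)
open import Relation.Unary using (Pred; Decidable)
open import Defs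

-- Vectors over 𝔽₂

infix 4 _≟ᵛ_

_≟ᵛ_ : ∀ {n} (v w : 𝔽₂^ n) → Dec (v ≡ w)
_≟ᵛ_ = Vecₚ.≡-dec Boolₚ._≟_

⊕-comm : ∀ {n} (v w : 𝔽₂^ n) → v ⊕ w ≡ w ⊕ v
⊕-comm = Vecₚ.zipWith-comm Boolₚ.xor-comm

⊕-assoc : ∀ {n} (u v w : 𝔽₂^ n) → (u ⊕ v) ⊕ w ≡ u ⊕ (v ⊕ w)
⊕-assoc = Vecₚ.zipWith-assoc Boolₚ.xor-assoc

⊕-identityˡ : ∀ {n} (v : 𝔽₂^ n) → 𝟎 ⊕ v ≡ v
⊕-identityˡ = Vecₚ.zipWith-identityˡ Boolₚ.xor-identityˡ

⊕-identityʳ : ∀ {n} (v : 𝔽₂^ n) → v ⊕ 𝟎 ≡ v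
⊕-identityʳ = Vecₚ.zipWith-identityʳ Boolₚ.xor-identityʳ

⊕-self : ∀ {n} (v : 𝔽₂^ n) → v ⊕ v ≡ 𝟎
⊕-self []      = ≡.refl
⊕-self (b ∷ v) = ≡.cong₂ _∷_ (Boolₚ.xor-same b) (⊕-self v)

⊕≡𝟎⇒≡ : ∀ {n} {v w : 𝔽₂^ n} → v ⊕ w ≡ 𝟎 → v ≡ w
⊕≡𝟎⇒≡ {v = v} {w} eq = begin
  v           ≡⟨ ⊕-identityʳ v ⟨
  v ⊕ 𝟎       ≡⟨ ≡.cong (v ⊕_) (⊕-self w) ⟨
  v ⊕ (w ⊕ w) ≡⟨ ⊕-assoc v w w ⟨
  (v ⊕ w) ⊕ w ≡⟨ ≡.cong (_⊕ w) eq ⟩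
  𝟎 ⊕ w       ≡⟨ ⊕-identityˡ w ⟩
  w           ∎
  where open ≡.≡-Reasoning

true· : ∀ {n} (v : 𝔽₂^ n) → true · v ≡ v
true· = Vecₚ.map-id

false· : ∀ {n} (v : 𝔽₂^ n) → false · v ≡ 𝟎
false· v = Vecₚ.map-const v false

allVectors : ∀ n → List (𝔽₂^ n)
allVectors zero    = [] ∷ []
allVectors (suc n) = map (false ∷_) (allVectors n) ++ map (true ∷_) (allVectors n)

length-allVectors : ∀ n → length (allVectors n) ≡ 2 ℕ.^ n
length-allVectors zero    = ≡.refl
length-allVectors (suc n) = begin
  length (map (false ∷_) vs ++ map (true ∷_) vs)        ≡⟨ Listₚ.length-++ (map (false ∷_) vs) ⟩
  length (map (false ∷_) vs) ℕ.+ length (map (true ∷_) vs)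
    ≡⟨ ≡.cong₂ ℕ._+_ (Listₚ.length-map (false ∷_) vs) (Listₚ.length-map (true ∷_) vs) ⟩
  length vs ℕ.+ length vs  ≡⟨ ≡.cong₂ ℕ._+_ ih (≡.trans ih (≡.sym (ℕₚ.+-identityʳ _))) ⟩
  2 ℕ.^ suc n ∎
  where
  open ≡.≡-Reasoning
  vs = allVectors n
  ih = length-allVectors n

∈-allVectors : ∀ {n} (v : 𝔽₂^ n) → v ∈ˡ allVectors n
∈-allVectors []                = here ≡.refl
∈-allVectors {suc n} (false ∷ v) = ∈ₚ.∈-++⁺ˡ (∈ₚ.∈-map⁺ (false ∷_) (∈-allVectors v))
∈-allVectors {suc n} (true ∷ v)  =
  ∈ₚ.∈-++⁺ʳ (map (false ∷_) (allVectors n)) (∈ₚ.∈-map⁺ (true ∷_) (∈-allVectors v))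

allVectors-distinct : ∀ n → AllPairs _≢_ (allVectors n)
allVectors-distinct zero    = [] ∷ []
allVectors-distinct (suc n) = AllPairsₚ.++⁺
  (AllPairsₚ.map⁺ (AllPairs.map (λ ne → ne ∘ Vecₚ.∷-injectiveʳ) (allVectors-distinct n)))
  (AllPairsₚ.map⁺ (AllPairs.map (λ ne → ne ∘ Vecₚ.∷-injectiveʳ) (allVectors-distinct n)))
  (Allₚ.map⁺ (All.universal (λ _ → Allₚ.map⁺ (All.universal (λ _ ()) _)) _))

-- Quantified over all decidable predicates, so that search over `A` iterates to vectors over `A`
-- and then to vectors of bases.
Searchable : Set → Set₁
Searchable A = ∀ {P : Pred A 0ℓ} → Decidable P → Dec (∃[ x ] P x)

search-Bool : Searchable Bool
search-Bool P? = map′ [ (false ,_) , (true ,_) ]′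
  (λ { (false , p) → inj₁ p ; (true , p) → inj₂ p }) (P? false ⊎-dec P? true)

search-Vec : ∀ {A} → Searchable A → ∀ n → Searchable (Vec A n)
search-Vec search zero    P? = map′ ([] ,_) (λ { ([] , p) → p }) (P? [])
search-Vec search (suc n) P? = map′
  (λ (x , xs , p) → x ∷ xs , p) (λ { (x ∷ xs , p) → x , xs , p })
  (search (λ x → search-Vec search n (λ xs → P? (x ∷ xs))))

∃-dec : ∀ {n} → Searchable (𝔽₂^ n)
∃-dec {n} = search-Vec search-Bool n

·-⊕ : ∀ {n} c (u v : 𝔽₂^ n) → c · (u ⊕ v) ≡ c · u ⊕ c · v
·-⊕ false u v = ≡.trans (false· _) (≡.sym (≡.trans
  (≡.cong₂ _⊕_ (false· u) (false· v)) (⊕-identityʳ 𝟎)))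
·-⊕ true  u v = ≡.trans (true· _) (≡.sym (≡.cong₂ _⊕_ (true· u) (true· v)))

⊕-interchange : ∀ {n} (a b c d : 𝔽₂^ n) → (a ⊕ b) ⊕ (c ⊕ d) ≡ (a ⊕ c) ⊕ (b ⊕ d)
⊕-interchange a b c d = begin
  (a ⊕ b) ⊕ (c ⊕ d) ≡⟨ ⊕-assoc a b (c ⊕ d) ⟩
  a ⊕ (b ⊕ (c ⊕ d)) ≡⟨ ≡.cong (a ⊕_) (⊕-assoc b c d) ⟨
  a ⊕ ((b ⊕ c) ⊕ d) ≡⟨ ≡.cong (λ z → a ⊕ (z ⊕ d)) (⊕-comm b c) ⟩
  a ⊕ ((c ⊕ b) ⊕ d) ≡⟨ ≡.cong (a ⊕_) (⊕-assoc c b d) ⟩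
  a ⊕ (c ⊕ (b ⊕ d)) ≡⟨ ⊕-assoc a c (b ⊕ d) ⟨
  (a ⊕ c) ⊕ (b ⊕ d) ∎
  where open ≡.≡-Reasoning

Additive : ∀ {m n} → (𝔽₂^ m → 𝔽₂^ n) → Set
Additive f = ∀ u v → f (u ⊕ v) ≡ f u ⊕ f v

additive-𝟎 : ∀ {m n} (f : 𝔽₂^ m → 𝔽₂^ n) → Additive f → f 𝟎 ≡ 𝟎
additive-𝟎 f f-⊕ = begin
  f 𝟎         ≡⟨ ≡.cong f (⊕-self 𝟎) ⟨
  f (𝟎 ⊕ 𝟎)   ≡⟨ f-⊕ 𝟎 𝟎 ⟩
  f 𝟎 ⊕ f 𝟎   ≡⟨ ⊕-self (f 𝟎) ⟩
  𝟎           ∎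
  where open ≡.≡-Reasoning

additive-· : ∀ {m n} (f : 𝔽₂^ m → 𝔽₂^ n) → Additive f → ∀ c v → f (c · v) ≡ c · f v
additive-· f f-⊕ false v =
  ≡.trans (≡.cong f (false· v)) (≡.trans (additive-𝟎 f f-⊕) (≡.sym (false· (f v))))
additive-· f f-⊕ true  v = ≡.trans (≡.cong f (true· v)) (≡.sym (true· (f v)))

-- Truncates f when it is longer than n.
pad : ∀ n → List Bool → 𝔽₂^ n
pad zero    _       = []
pad (suc n) []      = false ∷ pad n []
pad (suc n) (c ∷ f) = c ∷ pad n f

pad-[] : ∀ n → pad n [] ≡ 𝟎
pad-[] zero    = ≡.refl
pad-[] (suc n) = ≡.cong (false ∷_) (pad-[] n)

pad-toList : ∀ {n} (v : 𝔽₂^ n) → pad n (toList v) ≡ v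
pad-toList []      = ≡.refl
pad-toList (c ∷ v) = ≡.cong (c ∷_) (pad-toList v)

-- The length bound keeps the leading coefficient from being truncated: a monic polynomial of degree
-- below n has a nonzero coefficient vector.
pad-∷ʳ-true : ∀ n f → length f < n → pad n (f ∷ʳ true) ≢ 𝟎
pad-∷ʳ-true (suc n) []      _       ()
pad-∷ʳ-true (suc n) (c ∷ f) (s≤s l) eq = pad-∷ʳ-true n f l (Vecₚ.∷-injectiveʳ eq)

-- Rings of characteristic two

-- The sum 2 + 4 + ... + 2 ^ j, which is the degree of `differences j`.
geometric : ℕ → ℕ
geometric zero    = 0
geometric (suc j) = 2 ℕ.^ suc j ℕ.+ geometric j

geometric-sum : ∀ j → 2 ℕ.+ geometric j ≡ 2 ℕ.^ suc j
geometric-sum zero    = ≡.refl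
geometric-sum (suc j) = begin
  2 ℕ.+ (p ℕ.+ geometric j) ≡⟨ ℕₚ.+-assoc 2 p (geometric j) ⟨
  2 ℕ.+ p ℕ.+ geometric j   ≡⟨ ≡.cong (ℕ._+ geometric j) (ℕₚ.+-comm 2 p) ⟩
  p ℕ.+ 2 ℕ.+ geometric j   ≡⟨ ℕₚ.+-assoc p 2 (geometric j) ⟩
  p ℕ.+ (2 ℕ.+ geometric j) ≡⟨ ≡.cong (p ℕ.+_) (≡.trans (geometric-sum j) (≡.sym (ℕₚ.+-identityʳ p))) ⟩
  p ℕ.+ (p ℕ.+ 0)           ∎
  where
  open ≡.≡-Reasoning
  p = 2 ℕ.^ suc j

module CharacteristicTwo (K : CommutativeRing 0ℓ 0ℓ)
  (char2 : CommutativeRing._≈_ K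
             (CommutativeRing._+_ K (CommutativeRing.1# K) (CommutativeRing.1# K))
             (CommutativeRing.0# K))
  where

  open CommutativeRing K
  open SetoidReasoning setoid
  open RingSolver commutativeSemiring using (solve; _:+_; _:*_; _:=_)

  doubled≈0 : ∀ x → x + x ≈ 0#
  doubled≈0 x = begin
    x + x               ≈⟨ +-cong (*-identityˡ x) (*-identityˡ x) ⟨
    1# * x + 1# * x     ≈⟨ distribʳ x 1# 1# ⟨
    (1# + 1#) * x       ≈⟨ *-congʳ char2 ⟩
    0# * x              ≈⟨ zeroˡ x ⟩
    0#                  ∎

  cancel-doubled : ∀ x y → x + (y + y) ≈ x
  cancel-doubled x y = trans (+-congˡ (doubled≈0 y)) (+-identityʳ x)

  sum≈0⇒≈ : ∀ {x y} → x + y ≈ 0# → x ≈ y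
  sum≈0⇒≈ {x} {y} eq = begin
    x           ≈⟨ cancel-doubled x y ⟨
    x + (y + y) ≈⟨ +-assoc x y y ⟨
    x + y + y   ≈⟨ +-congʳ eq ⟩
    0# + y      ≈⟨ +-identityˡ y ⟩
    y           ∎

  ≈⇒sum≈0 : ∀ {x y} → x ≈ y → x + y ≈ 0#
  ≈⇒sum≈0 {x} {y} eq = trans (+-congʳ eq) (doubled≈0 y)

  -- frob i x = x ^ (2 ^ i)
  frob : ℕ → Carrier → Carrier
  frob zero    x = x
  frob (suc i) x = frob i x * frob i x

  frob-cong : ∀ i {x y} → x ≈ y → frob i x ≈ frob i y
  frob-cong zero    eq = eq
  frob-cong (suc i) eq = *-cong (frob-cong i eq) (frob-cong i eq)

  frob-∘ : ∀ i j x → frob (i ℕ.+ j) x ≈ frob i (frob j x)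
  frob-∘ zero    j x = refl
  frob-∘ (suc i) j x = *-cong (frob-∘ i j x) (frob-∘ i j x)

  frob-0# : ∀ i → frob i 0# ≈ 0#
  frob-0# zero    = refl
  frob-0# (suc i) = trans (*-congʳ (frob-0# i)) (zeroˡ _)

  frob-1# : ∀ i → frob i 1# ≈ 1#
  frob-1# zero    = refl
  frob-1# (suc i) = trans (*-cong (frob-1# i) (frob-1# i)) (*-identityˡ 1#)

  frob-* : ∀ i x y → frob i (x * y) ≈ frob i x * frob i y
  frob-* zero    x y = refl
  frob-* (suc i) x y = trans (*-cong (frob-* i x y) (frob-* i x y))
    (solve 2 (λ a b → (a :* b) :* (a :* b) := (a :* a) :* (b :* b)) refl _ _)

  -- Squaring is additive because the two equal cross terms cancel.
  frob-+ : ∀ i x y → frob i (x + y) ≈ frob i x + frob i y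
  frob-+ zero    x y = refl
  frob-+ (suc i) x y = trans (*-cong (frob-+ i x y) (frob-+ i x y)) (trans
    (solve 2 (λ a b → (a :+ b) :* (a :+ b) := (a :* a :+ b :* b) :+ (a :* b :+ a :* b)) refl _ _)
    (cancel-doubled _ _))

  bit : Bool → Carrier
  bit false = 0#
  bit true  = 1#

  bit-xor : ∀ a b → bit (a xor b) ≈ bit a + bit b
  bit-xor false b     = sym (+-identityˡ _)
  bit-xor true  false = sym (+-identityʳ _)
  bit-xor true  true  = sym char2

  frob-bit : ∀ i b → frob i (bit b) ≈ bit b
  frob-bit i false = frob-0# i
  frob-bit i true  = frob-1# i

  eval : List Bool → Carrier → Carrier
  eval []      y = 0#
  eval (c ∷ f) y = bit c + y * eval f y

  -- `frob i` is a ring homomorphism fixing the coefficients 0 and 1. Hence the conjugates of a root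
  -- are roots of the same polynomial.
  frob-eval : ∀ i f y → frob i (eval f y) ≈ eval f (frob i y)
  frob-eval i []      y = frob-0# i
  frob-eval i (c ∷ f) y = trans (frob-+ i _ _)
    (+-cong (frob-bit i c) (trans (frob-* i _ _) (*-congˡ (frob-eval i f y))))

  eval-⊕ : ∀ {n} (a b : 𝔽₂^ n) y →
           eval (toList (a ⊕ b)) y ≈ eval (toList a) y + eval (toList b) y
  eval-⊕ []      []      y = sym (+-identityʳ 0#)
  eval-⊕ (c ∷ a) (d ∷ b) y = trans (+-cong (bit-xor c d) (*-congˡ (eval-⊕ a b y)))
    (solve 5 (λ c d y p q → (c :+ d) :+ y :* (p :+ q) := (c :+ y :* p) :+ (d :+ y :* q))
      refl _ _ _ _ _)

  -- Monic polynomials and their roots.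

  -- Monic polynomial functions of degree d with coefficients in C, in Horner form.
  data Monic (C : Pred Carrier 0ℓ) : ℕ → (Carrier → Carrier) → Set where
    one   : ∀ {f} → (∀ y → f y ≈ 1#) → Monic C 0 f
    step  : ∀ {d f g c} → C c → Monic C d g → (∀ y → f y ≈ y * g y + c) → Monic C (suc d) f

  monic-resp : ∀ {C d f g} → (∀ y → f y ≈ g y) → Monic C d g → Monic C d f
  monic-resp eq (one g≈1)      = one (λ y → trans (eq y) (g≈1 y))
  monic-resp eq (step c m g≈)  = step c m (λ y → trans (eq y) (g≈ y))

  -- Coefficients in `Bit` allow a polynomial to be read back as a list of bits; unrestricted
  -- coefficients are what dividing by a root requires.
  record Subring (C : Pred Carrier 0ℓ) : Set where
    field
      0∈       : C 0#
      1∈       : C 1#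
      +-closed : ∀ {a b} → C a → C b → C (a + b)
      *-closed : ∀ {a b} → C a → C b → C (a * b)

  data Bit : Pred Carrier 0ℓ where
    is-bit : ∀ {c} b → c ≈ bit b → Bit c

  bits-subring : Subring Bit
  bits-subring = record
    { 0∈ = is-bit false refl
    ; 1∈ = is-bit true refl
    ; +-closed = λ { (is-bit a p) (is-bit b q) →
        is-bit (a xor b) (trans (+-cong p q) (sym (bit-xor a b))) }
    ; *-closed = λ { (is-bit false p) q → is-bit false (trans (*-congʳ p) (zeroˡ _))
                   ; (is-bit true p) (is-bit b q) →
                       is-bit b (trans (*-cong p q) (*-identityˡ _)) }
    }

  everything-subring : Subring (λ _ → ⊤)
  everything-subring = record
    { 0∈ = tt ; 1∈ = tt ; +-closed = λ _ _ → tt ; *-closed = λ _ _ → tt }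

  module _ {C : Pred Carrier 0ℓ} (subring : Subring C) where
    open Subring subring

    -- As d < D, adding a multiple of `q` leaves the leading coefficient of `p` alone.
    monic-+ : ∀ {D d p q a} → C a → Monic C D p → Monic C d q → d < D →
              Monic C D (λ y → p y + a * q y)
    monic-+ {a = a} a∈ (step {c = c} c∈ P p≈) (one q≈1) _ =
      step (+-closed c∈ a∈) P λ y → trans
        (+-cong (p≈ y) (trans (*-congˡ (q≈1 y)) (*-identityʳ a))) (+-assoc _ _ _)
    monic-+ a∈ (step c∈ P p≈) (step e∈ Q q≈) (s≤s d<D) =
      step (+-closed c∈ (*-closed a∈ e∈)) (monic-+ a∈ P Q d<D) λ y → trans
        (+-cong (p≈ y) (*-congˡ (q≈ y)))
        (solve 6 (λ y p c a q e → (y :* p :+ c) :+ a :* (y :* q :+ e)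
                               := y :* (p :+ a :* q) :+ (c :+ a :* e)) refl _ _ _ _ _ _)

    monic-* : ∀ {d e f g} → Monic C d f → Monic C e g →
              Monic C (d ℕ.+ e) (λ y → f y * g y)
    monic-* (one f≈1) G =
      monic-resp (λ y → trans (*-congʳ (f≈1 y)) (*-identityˡ _)) G
    monic-* {suc d} {e} (step c∈ F f≈) G = monic-resp
      (λ y → trans (*-congʳ (f≈ y)) (solve 4 (λ y f c g →
        (y :* f :+ c) :* g := y :* (f :* g) :+ c :* g) refl _ _ _ _))
      (monic-+ c∈ (step 0∈ (monic-* F G) (λ y → sym (+-identityʳ _))) G
        (s≤s (ℕₚ.m≤n+m e d)))

    monic-id : Monic C 1 (λ y → y)
    monic-id = step 0∈ (one (λ _ → refl))
      (λ y → sym (trans (+-identityʳ _) (*-identityʳ y)))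

    monic-frob : ∀ i → Monic C (2 ℕ.^ i) (frob i)
    monic-frob zero    = monic-id
    monic-frob (suc i) = ≡.subst (λ d → Monic C d (frob (suc i)))
      (≡.cong (2 ℕ.^ i ℕ.+_) (≡.sym (ℕₚ.+-identityʳ (2 ℕ.^ i))))
      (monic-* (monic-frob i) (monic-frob i))

    monic-frob+id : ∀ i → 1 ≤ i → Monic C (2 ℕ.^ i) (λ y → frob i y + y)
    monic-frob+id i 1≤i = monic-resp (λ y → +-congˡ (sym (*-identityˡ y)))
      -- Monotonicity gives 2 ≤ 2 ^ i, so the term y has strictly smaller degree than y ^ (2 ^ i).
      (monic-+ 1∈ (monic-frob i) monic-id (ℕₚ.^-monoʳ-≤ 2 1≤i))

    -- Signs do not matter: this is f y - f a = (y - a) q y.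
    monic-quotient : ∀ {d f} a → C a → Monic C (suc d) f →
      ∃[ q ] Monic C d q × (∀ y → f y + f a ≈ (y + a) * q y)
    monic-quotient {f = f} a a∈ (step {g = g} {c} c∈ (one g≈1) f≈) =
      (λ _ → 1#) , one (λ _ → refl) , λ y → begin
        f y + f a                     ≈⟨ +-cong (f≈ y) (f≈ a) ⟩
        (y * g y + c) + (a * g a + c) ≈⟨ +-cong (+-congʳ (*-congˡ (g≈1 y)))
                                                (+-congʳ (*-congˡ (g≈1 a))) ⟩
        (y * 1# + c) + (a * 1# + c)   ≈⟨ solve 4 (λ y a c i → (y :* i :+ c) :+ (a :* i :+ c)
                                           := (y :+ a) :* i :+ (c :+ c)) refl y a c 1# ⟩
        (y + a) * 1# + (c + c)        ≈⟨ cancel-doubled _ c ⟩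
        (y + a) * 1#                  ∎
    monic-quotient {f = f} a a∈ (step {g = g} {c} c∈ G@(step _ _ _) f≈) with monic-quotient a a∈ G
    ... | q , Q , q-eq = (λ y → g y + a * q y) , monic-+ a∈ G Q ℕₚ.≤-refl , λ y → begin
        f y + f a                     ≈⟨ +-cong (f≈ y) (f≈ a) ⟩
        -- Adding `a * g y` twice splits off (y + a) g y and leaves a (g y + g a), to which the
        -- induction hypothesis applies.
        (y * g y + c) + (a * g a + c) ≈⟨ cancel-doubled _ (a * g y) ⟨
        (y * g y + c) + (a * g a + c) + (a * g y + a * g y)
          ≈⟨ solve 5 (λ y a c gy ga → (y :* gy :+ c) :+ (a :* ga :+ c) :+ (a :* gy :+ a :* gy)
               := ((y :+ a) :* gy :+ a :* (gy :+ ga)) :+ (c :+ c)) refl y a c (g y) (g a) ⟩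
        ((y + a) * g y + a * (g y + g a)) + (c + c) ≈⟨ cancel-doubled _ c ⟩
        (y + a) * g y + a * (g y + g a)             ≈⟨ +-congˡ (*-congˡ (q-eq y)) ⟩
        (y + a) * g y + a * ((y + a) * q y)
          ≈⟨ solve 4 (λ s a g q → s :* g :+ a :* (s :* q) := s :* (g :+ a :* q)) refl _ _ _ _ ⟩
        (y + a) * (g y + a * q y) ∎

  -- Passes from a polynomial function to its coefficient list, constant term first; the final
  -- `true` is the leading coefficient.
  monic-bits⇒eval : ∀ {d f} → Monic Bit d f →
    ∃[ l ] (length l ≡ d × (∀ y → f y ≈ eval (l ∷ʳ true) y))
  monic-bits⇒eval (one f≈1) = [] , ≡.refl , λ y →
    trans (f≈1 y) (sym (trans (+-congˡ (zeroʳ y)) (+-identityʳ 1#)))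
  monic-bits⇒eval (step {g = g} {c = c} (is-bit b c≈) G f≈) with monic-bits⇒eval G
  ... | l , len , g≈ = b ∷ l , ≡.cong suc len , λ y →
    trans (f≈ y) (trans (+-comm _ _) (+-cong c≈ (*-congˡ (g≈ y))))

  eval-𝟎 : ∀ n y → eval (toList (𝟎 {n})) y ≈ 0#
  eval-𝟎 zero    y = refl
  eval-𝟎 (suc n) y = trans (+-identityˡ _) (trans (*-congˡ (eval-𝟎 n y)) (zeroʳ y))

  -- Over 𝔽₂ the last nonzero coefficient is necessarily 1.
  𝟎-or-monic : ∀ {n} (a : 𝔽₂^ n) →
    a ≡ 𝟎 ⊎ ∃[ d ] (d < n × Monic (λ _ → ⊤) d (eval (toList a)))
  𝟎-or-monic []      = inj₁ ≡.refl
  𝟎-or-monic {suc n} (c ∷ a) with 𝟎-or-monic a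
  ... | inj₂ (d , d<n , A) = inj₂ (suc d , s≤s d<n , step tt A (λ y → +-comm _ _))
  𝟎-or-monic (false ∷ a) | inj₁ ≡.refl = inj₁ ≡.refl
  𝟎-or-monic {suc n} (true ∷ a)  | inj₁ ≡.refl = inj₂ (0 , s≤s z≤n , one λ y →
    trans (+-congˡ (trans (*-congˡ (eval-𝟎 n y)) (zeroʳ y))) (+-identityʳ 1#))

  -- The product of y ^ (2 ^ d) - y over 1 ≤ d ≤ j. In a field it is nonzero exactly when none of
  -- these powers of Frobenius fixes y.
  differences : ℕ → Carrier → Carrier
  differences zero    y = 1#
  differences (suc j) y = (frob (suc j) y + y) * differences j y

  monic-differences : ∀ j → Monic Bit (geometric j) (differences j)
  monic-differences zero    = one (λ _ → refl)
  monic-differences (suc j) = monic-* bits-subring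
    (monic-frob+id bits-subring (suc j) (s≤s z≤n)) (monic-differences j)

  differences-factor : ∀ {d j} → 1 ≤ d → d ≤ j → ∀ y →
    ∃[ w ] differences j y ≈ (frob d y + y) * w
  differences-factor {d} {zero}  1≤d d≤0 y = ⊥-elim (ℕₚ.<⇒≱ 1≤d d≤0)
  differences-factor {d} {suc j} 1≤d d≤j y with d ℕₚ.≟ suc j
  ... | yes ≡.refl = differences j y , refl
  ... | no  d≢     with differences-factor 1≤d (ℕₚ.≤-pred (ℕₚ.≤∧≢⇒< d≤j d≢)) y
  ...   | w , eq = (frob (suc j) y + y) * w , trans (*-congˡ eq)
    (solve 3 (λ a b w → a :* (b :* w) := b :* (a :* w)) refl _ _ _)

  frob-divisible : ∀ i r → ∃[ s ] frob i r ≈ r * s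
  frob-divisible zero    r = 1# , sym (*-identityʳ r)
  frob-divisible (suc i) r with frob-divisible i r
  ... | s , eq = s * frob i r , trans (*-congʳ eq) (*-assoc r s _)

  -- Von Neumann regularity: if r ^ (2 ^ i) = r s, then squaring gives r = (r s) ^ 2 = r (r s ^ 2).
  frob-period⇒regular : ∀ i → (∀ r → frob (suc i) r ≈ r) → ∀ r → ∃[ s ] r * (r * s) ≈ r
  frob-period⇒regular i period r with frob-divisible i r
  ... | s , eq = s * s , trans
    (solve 2 (λ r s → r :* (r :* (s :* s)) := (r :* s) :* (r :* s)) refl r s)
    (trans (sym (*-cong eq eq)) (period r))

  module IntegralDomain (nontrivial : ¬ 1# ≈ 0#)
    (integral : ∀ {x y} → x * y ≈ 0# → ¬ x ≈ 0# → y ≈ 0#)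
    where

    -- Divide by y - a for the first root a; every other listed root differs from a, so it is a root
    -- of the quotient.
    roots≤degree : ∀ {d f} → Monic (λ _ → ⊤) d f → ∀ ys → AllPairs (λ a b → ¬ a ≈ b) ys →
                   All (λ y → f y ≈ 0#) ys → length ys ≤ d
    roots≤degree F       []       _          _          = z≤n
    roots≤degree (one f≈1) (a ∷ ys) _        (fa ∷ _)   =
      ⊥-elim (nontrivial (trans (sym (f≈1 a)) fa))
    roots≤degree {suc d} {f} F@(step _ _ _) (a ∷ ys) (a# ∷ ys#) (fa ∷ fys)
      with monic-quotient everything-subring a tt F
    ... | q , Q , q-eq = s≤s (roots≤degree Q ys ys# (All.zipWith (λ {y} → qy≈0 {y}) (a# , fys)))
      where
      qy≈0 : ∀ {y} → ¬ a ≈ y × f y ≈ 0# → q y ≈ 0#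
      qy≈0 {y} (a≉y , fy) = integral
        (trans (sym (q-eq y)) (trans (+-cong fy fa) (+-identityʳ 0#)))
        (λ eq → a≉y (sym (sum≈0⇒≈ eq)))

-- Interpolation by additive quadratics over a finite field.

-- All that the covering construction has to know about the field: additive maps indexed by pairs
-- (a, b), one of which takes any prescribed values at two independent points.
record InterpolatingFamily (m : ℕ) : Set where
  field
    at          : 𝔽₂^ m → 𝔽₂^ m → 𝔽₂^ m → 𝔽₂^ m
    additive    : ∀ a b → Additive (at a b)
    interpolate : ∀ {s t} → s ≢ 𝟎 → t ≢ 𝟎 → s ≢ t → ∀ v w →
                  ∃[ a ] ∃[ b ] (at a b s ≡ v × at a b t ≡ w)

module FiniteField (K : CommutativeRing 0ℓ 0ℓ)
  (char2 : CommutativeRing._≈_ K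
             (CommutativeRing._+_ K (CommutativeRing.1# K) (CommutativeRing.1# K))
             (CommutativeRing.0# K))
  where

  open CommutativeRing K
  open CharacteristicTwo K char2
  open RingSolver commutativeSemiring using (solve; _:+_; _:*_; _:=_)

  -- The order 2 ^ m is derived, not assumed: `y-primitive` bounds it from below and `frob-period`
  -- from above.
  module _ (nontrivial : ¬ 1# ≈ 0#)
    (zero-or-unit : ∀ x → x ≈ 0# ⊎ ∃[ x⁻¹ ] x * x⁻¹ ≈ 1#)
    (_≟_ : ∀ x y → Dec (x ≈ y))
    (m : ℕ) (1≤m : 1 ≤ m)
    (frob-period : ∀ z → frob m z ≈ z)
    (y : Carrier) (y-primitive : ∀ d → 1 ≤ d → d < m → ¬ frob d y ≈ y)
    where

    open SetoidReasoning setoid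

    integral : ∀ {a b} → a * b ≈ 0# → ¬ a ≈ 0# → b ≈ 0#
    integral {a} {b} ab≈0 a≉0 with zero-or-unit a
    ... | inj₁ a≈0 = ⊥-elim (a≉0 a≈0)
    ... | inj₂ (a⁻¹ , inv) = begin
      b             ≈⟨ *-identityˡ b ⟨
      1# * b        ≈⟨ *-congʳ inv ⟨
      a * a⁻¹ * b   ≈⟨ solve 3 (λ a i b → a :* i :* b := i :* (a :* b)) refl a a⁻¹ b ⟩
      a⁻¹ * (a * b) ≈⟨ *-congˡ ab≈0 ⟩
      a⁻¹ * 0#      ≈⟨ zeroʳ a⁻¹ ⟩
      0#            ∎

    divide : ∀ a b → ¬ a ≈ 0# → ∃[ c ] a * c ≈ b
    divide a b a≉0 with zero-or-unit a
    ... | inj₁ a≈0 = ⊥-elim (a≉0 a≈0)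
    ... | inj₂ (a⁻¹ , inv) = a⁻¹ * b , (begin
      a * (a⁻¹ * b) ≈⟨ *-assoc a a⁻¹ b ⟨
      a * a⁻¹ * b   ≈⟨ *-congʳ inv ⟩
      1# * b        ≈⟨ *-identityˡ b ⟩
      b             ∎)

    open IntegralDomain nontrivial integral

    -- Applying `frob (m - j)` to an equality of conjugates turns the right side into y and the left
    -- side into its conjugate of index m - j + i, which lies strictly between 0 and m.
    conjugates-distinct : ∀ {i j} → i < j → j < m → ¬ frob i y ≈ frob j y
    conjugates-distinct {i} {j} i<j j<m eq = y-primitive (m ℕ.∸ j ℕ.+ i)
      (ℕₚ.≤-trans (ℕₚ.m<n⇒0<n∸m j<m) (ℕₚ.m≤m+n _ i))
      (ℕₚ.<-≤-trans (ℕₚ.+-monoʳ-< (m ℕ.∸ j) i<j) (ℕₚ.≤-reflexive m∸j+j≡m))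
      (begin
        frob (m ℕ.∸ j ℕ.+ i) y      ≈⟨ frob-∘ (m ℕ.∸ j) i y ⟩
        frob (m ℕ.∸ j) (frob i y)   ≈⟨ frob-cong (m ℕ.∸ j) eq ⟩
        frob (m ℕ.∸ j) (frob j y)   ≈⟨ frob-∘ (m ℕ.∸ j) j y ⟨
        frob (m ℕ.∸ j ℕ.+ j) y      ≡⟨ ≡.cong (λ i → frob i y) m∸j+j≡m ⟩
        frob m y                    ≈⟨ frob-period y ⟩
        y                           ∎)
      where
      m∸j+j≡m = ℕₚ.m∸n+n≡m (ℕₚ.<⇒≤ j<m)

    toK : 𝔽₂^ m → Carrier
    toK a = eval (toList a) y

    -- A nonzero polynomial of degree < m over 𝔽₂ cannot vanish at the m conjugates of y.
    toK-kernel : ∀ a → toK a ≈ 0# → a ≡ 𝟎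
    toK-kernel a eq with 𝟎-or-monic a
    ... | inj₁ a≡𝟎            = a≡𝟎
    ... | inj₂ (d , d<m , A) = ⊥-elim (ℕₚ.<⇒≱ d<m (≡.subst (_≤ d)
      (Listₚ.length-applyUpTo _ m)
      (roots≤degree A (applyUpTo (λ i → frob i y) m)
        (AllPairsₚ.applyUpTo⁺₁ _ m conjugates-distinct)
        (Allₚ.applyUpTo⁺₂ _ m (λ i → trans (sym (frob-eval i (toList a) y))
          (trans (frob-cong i eq) (frob-0# i)))))))

    toK-injective : ∀ {a b} → toK a ≈ toK b → a ≡ b
    toK-injective {a} {b} eq = ⊕≡𝟎⇒≡ (toK-kernel (a ⊕ b)
      (trans (eval-⊕ a b y) (≈⇒sum≈0 eq)))

    -- Otherwise y ^ (2 ^ m) - y would have more than 2 ^ m roots.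
    toK-surjective : ∀ z → ∃[ a ] toK a ≈ z
    toK-surjective z with ∃-dec (λ a → toK a ≟ z)
    ... | yes found = found
    ... | no  ∄a    = ⊥-elim (ℕₚ.<-irrefl ≡.refl (≡.subst (_≤ 2 ℕ.^ m)
      (≡.cong suc (≡.trans (Listₚ.length-map toK (allVectors m)) (length-allVectors m)))
      (roots≤degree (monic-frob+id everything-subring m 1≤m)
        (z ∷ map toK (allVectors m))
        (Allₚ.map⁺ (All.universal (λ a eq → ∄a (a , sym eq)) _) ∷
         AllPairsₚ.map⁺ (AllPairs.map (_∘ toK-injective) (allVectors-distinct m)))
        (All.universal (λ x → ≈⇒sum≈0 (frob-period x)) _))))

    fromK : Carrier → 𝔽₂^ m
    fromK z = proj₁ (toK-surjective z)

    toK-fromK : ∀ z → toK (fromK z) ≈ z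
    toK-fromK z = proj₂ (toK-surjective z)

    fromK-unique : ∀ {z a} → z ≈ toK a → fromK z ≡ a
    fromK-unique eq = toK-injective (trans (toK-fromK _) eq)

    toK-≉0 : ∀ {a} → a ≢ 𝟎 → ¬ toK a ≈ 0#
    toK-≉0 a≢𝟎 eq = a≢𝟎 (toK-injective (trans eq (sym (eval-𝟎 m y))))

    quadratic : Carrier → Carrier → Carrier → Carrier
    quadratic a b u = a * u + b * (u * u)

    -- The quadratics (u + t) u β and (u + s) u α vanish at t and at s respectively.
    solve-quadratic : ∀ {s t} → ¬ s ≈ 0# → ¬ t ≈ 0# → ¬ s ≈ t → ∀ v w →
      ∃[ a ] ∃[ b ] (quadratic a b s ≈ v × quadratic a b t ≈ w)
    solve-quadratic {s} {t} s≉0 t≉0 s≉t v w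
      with divide (s * (s + t)) v (λ eq → s≉t (sum≈0⇒≈ (integral eq s≉0)))
         | divide (t * (s + t)) w (λ eq → s≉t (sum≈0⇒≈ (integral eq t≉0)))
    ... | β , β-eq | α , α-eq = s * α + t * β , α + β ,
      (begin
        (s * α + t * β) * s + (α + β) * (s * s)
          ≈⟨ solve 4 (λ s t α β → (s :* α :+ t :* β) :* s :+ (α :+ β) :* (s :* s)
               := s :* (s :+ t) :* β :+ (s :* s :* α :+ s :* s :* α)) refl s t α β ⟩
        s * (s + t) * β + (s * s * α + s * s * α) ≈⟨ cancel-doubled _ _ ⟩
        s * (s + t) * β                           ≈⟨ β-eq ⟩
        v                                         ∎) ,
      (begin
        (s * α + t * β) * t + (α + β) * (t * t)
          ≈⟨ solve 4 (λ s t α β → (s :* α :+ t :* β) :* t :+ (α :+ β) :* (t :* t)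
               := t :* (s :+ t) :* α :+ (t :* t :* β :+ t :* t :* β)) refl s t α β ⟩
        t * (s + t) * α + (t * t * β + t * t * β) ≈⟨ cancel-doubled _ _ ⟩
        t * (s + t) * α                           ≈⟨ α-eq ⟩
        w                                         ∎)

    quadratic-+ : ∀ a b u v → quadratic a b (u + v) ≈ quadratic a b u + quadratic a b v
    quadratic-+ a b u v = trans
      (solve 4 (λ a b u v → a :* (u :+ v) :+ b :* ((u :+ v) :* (u :+ v))
         := (a :* u :+ b :* (u :* u)) :+ (a :* v :+ b :* (v :* v))
            :+ (b :* (u :* v) :+ b :* (u :* v))) refl a b u v)
      (cancel-doubled _ _)

    quadratic-cong : ∀ {a a′ b b′ u u′} → a ≈ a′ → b ≈ b′ → u ≈ u′ →
                     quadratic a b u ≈ quadratic a′ b′ u′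
    quadratic-cong p q r = +-cong (*-cong p r) (*-cong q (*-cong r r))

    quadratics : InterpolatingFamily m
    quadratics = record
      { at = λ a b u → fromK (quadratic (toK a) (toK b) (toK u))
      ; additive = λ a b u v → fromK-unique (begin
          quadratic (toK a) (toK b) (toK (u ⊕ v))
            ≈⟨ quadratic-cong refl refl (eval-⊕ u v y) ⟩
          quadratic (toK a) (toK b) (toK u + toK v) ≈⟨ quadratic-+ _ _ _ _ ⟩
          quadratic (toK a) (toK b) (toK u) + quadratic (toK a) (toK b) (toK v)
            ≈⟨ +-cong (toK-fromK _) (toK-fromK _) ⟨
          toK (fromK (quadratic (toK a) (toK b) (toK u))) +
          toK (fromK (quadratic (toK a) (toK b) (toK v)))
            ≈⟨ eval-⊕ (fromK (quadratic (toK a) (toK b) (toK u)))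
                      (fromK (quadratic (toK a) (toK b) (toK v))) y ⟨
          toK (fromK (quadratic (toK a) (toK b) (toK u)) ⊕
               fromK (quadratic (toK a) (toK b) (toK v))) ∎)
      ; interpolate = λ {s} {t} s≢𝟎 t≢𝟎 s≢t v w →
          let a , b , eqs , eqt = solve-quadratic (toK-≉0 s≢𝟎) (toK-≉0 t≢𝟎)
                                    (s≢t ∘ toK-injective) (toK v) (toK w)
          in  fromK a , fromK b ,
              fromK-unique (trans (quadratic-cong (toK-fromK a) (toK-fromK b) refl) eqs) ,
              fromK-unique (trans (quadratic-cong (toK-fromK a) (toK-fromK b) refl) eqt)
      }

-- Field quotients of von Neumann regular rings.

-- R / Ann ε, carried by R itself.
module QuotientByAnnihilator (R : CommutativeRing 0ℓ 0ℓ) (ε : CommutativeRing.Carrier R) where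

  open CommutativeRing R
  open SetoidReasoning setoid

  infix 4 _≈ᵋ_

  _≈ᵋ_ : Carrier → Carrier → Set
  a ≈ᵋ b = ε * a ≈ ε * b

  quotient : CommutativeRing 0ℓ 0ℓ
  quotient = record
    { Carrier = Carrier ; _≈_ = _≈ᵋ_ ; _+_ = _+_ ; _*_ = _*_ ; -_ = -_ ; 0# = 0# ; 1# = 1#
    ; isCommutativeRing = record
      { isRing = record
        { +-isAbelianGroup = record
          { isGroup = record
            { isMonoid = record
              { isSemigroup = record
                { isMagma = record
                  { isEquivalence = record { refl = refl ; sym = sym ; trans = trans }
                  ; ∙-cong = λ {a} {b} {c} {d} p q → begin
                      ε * (a + c)   ≈⟨ distribˡ ε a c ⟩
                      ε * a + ε * c ≈⟨ +-cong p q ⟩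
                      ε * b + ε * d ≈⟨ distribˡ ε b d ⟨
                      ε * (b + d)   ∎
                  }
                ; assoc = λ a b c → *-congˡ (+-assoc a b c)
                }
              ; identity = (λ a → *-congˡ (+-identityˡ a)) , (λ a → *-congˡ (+-identityʳ a))
              }
            ; inverse = (λ a → *-congˡ (-‿inverseˡ a)) , (λ a → *-congˡ (-‿inverseʳ a))
            ; ⁻¹-cong = λ {a} {b} p → begin
                ε * - a   ≈⟨ -‿distribʳ-* ε a ⟨
                - (ε * a) ≈⟨ -‿cong p ⟩
                - (ε * b) ≈⟨ -‿distribʳ-* ε b ⟩
                ε * - b   ∎
            }
          ; comm = λ a b → *-congˡ (+-comm a b)
          }
        ; *-cong = λ {a} {b} {c} {d} p q → begin
            ε * (a * c) ≈⟨ *-assoc ε a c ⟨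
            ε * a * c   ≈⟨ *-congʳ p ⟩
            ε * b * c   ≈⟨ swap ε b c ⟩
            ε * c * b   ≈⟨ *-congʳ q ⟩
            ε * d * b   ≈⟨ swap ε d b ⟩
            ε * b * d   ≈⟨ *-assoc ε b d ⟩
            ε * (b * d) ∎
        ; *-assoc = λ a b c → *-congˡ (*-assoc a b c)
        ; *-identity = (λ a → *-congˡ (*-identityˡ a)) , (λ a → *-congˡ (*-identityʳ a))
        ; distrib = (λ a b c → *-congˡ (distribˡ a b c)) , (λ a b c → *-congˡ (distribʳ a b c))
        }
      ; *-comm = λ a b → *-congˡ (*-comm a b)
      }
    }
    where
    open Ringₚ ring using (-‿distribʳ-*)
    swap : ∀ a b c → a * b * c ≈ a * c * b
    swap a b c = trans (*-assoc a b c) (trans (*-congˡ (*-comm b c)) (sym (*-assoc a c b)))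

module FieldQuotient (R : CommutativeRing 0ℓ 0ℓ)
  (_≟_ : ∀ x y → Dec (CommutativeRing._≈_ R x y))
  (regular : ∀ r → ∃[ s ] CommutativeRing._≈_ R (CommutativeRing._*_ R r (CommutativeRing._*_ R r s)) r)
  where

  open CommutativeRing R
  open RingSolver commutativeSemiring using (solve; _:*_; _:=_)
  open SetoidReasoning setoid

  -- Multiplying ε successively by every element that does not kill it makes each element
  -- zero or invertible modulo Ann ε.
  maximal-annihilator : ∀ vs ε → ¬ ε ≈ 0# → ∃[ μ ]
    (¬ μ ≈ 0# × (∃[ w ] μ ≈ ε * w) ×
     All (λ v → μ * v ≈ 0# ⊎ ∃[ s ] μ * (v * s) ≈ μ) vs)
  maximal-annihilator []       ε ε≉0 = ε , ε≉0 , (1# , sym (*-identityʳ ε)) , []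
  maximal-annihilator (v ∷ vs) ε ε≉0 with (ε * v) ≟ 0#
  ... | yes εv≈0 with maximal-annihilator vs ε ε≉0
  ...   | μ , μ≉0 , (w , μ≈) , rest = μ , μ≉0 , (w , μ≈) , inj₁ (begin
            μ * v       ≈⟨ *-congʳ μ≈ ⟩
            ε * w * v   ≈⟨ solve 3 (λ e w v → e :* w :* v := e :* v :* w) refl ε w v ⟩
            ε * v * w   ≈⟨ *-congʳ εv≈0 ⟩
            0# * w      ≈⟨ zeroˡ w ⟩
            0#          ∎) ∷ rest
  maximal-annihilator (v ∷ vs) ε ε≉0 | no εv≉0
    with maximal-annihilator vs (ε * v) εv≉0 | regular v
  -- Since μ is a multiple of ε v and v v s = v, multiplication by v s fixes μ: `s` is an inverse of
  -- `v` modulo Ann μ.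
  ... | μ , μ≉0 , (w , μ≈) , rest | s , vvs≈v =
    μ , μ≉0 , (v * w , trans μ≈ (*-assoc ε v w)) , inj₂ (s , (begin
      μ * (v * s)           ≈⟨ *-congʳ μ≈ ⟩
      ε * v * w * (v * s)   ≈⟨ solve 4 (λ e v w s → e :* v :* w :* (v :* s)
                                 := e :* (v :* (v :* s)) :* w) refl ε v w s ⟩
      ε * (v * (v * s)) * w ≈⟨ *-congʳ (*-congˡ vvs≈v) ⟩
      ε * v * w             ≈⟨ μ≈ ⟨
      μ                     ∎)) ∷ rest

  -- Regularity l = l l s gives μ = l w = l l s w = (μ l) s.
  annihilates-factor⇒≈0 : ∀ {μ l w} → μ ≈ l * w → μ * l ≈ 0# → μ ≈ 0#
  annihilates-factor⇒≈0 {μ} {l} {w} μ≈lw μl≈0 with regular l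
  ... | s , lls≈l = begin
    μ               ≈⟨ μ≈lw ⟩
    l * w           ≈⟨ *-congʳ lls≈l ⟨
    l * (l * s) * w ≈⟨ solve 3 (λ l s w → l :* (l :* s) :* w := l :* w :* l :* s) refl l s w ⟩
    l * w * l * s   ≈⟨ *-congʳ (*-congʳ μ≈lw) ⟨
    μ * l * s       ≈⟨ *-congʳ μl≈0 ⟩
    0# * s          ≈⟨ zeroˡ s ⟩
    0#              ∎

-- The field with 2 ^ m elements

-- 𝔽₂[x] / (x ^ N - 1) for N = suc D, where multiplication by x rotates the coefficient vector.
module CyclicRing (D : ℕ) where

  open ≡.≡-Reasoning

  private
    V : Set
    V = 𝔽₂^ (suc D)

  lastBit : ∀ {n} → 𝔽₂^ (suc n) → Bool
  lastBit {zero}  (b ∷ []) = b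
  lastBit {suc n} (b ∷ v)  = lastBit v

  dropLast : ∀ {n} → 𝔽₂^ (suc n) → 𝔽₂^ n
  dropLast {zero}  (b ∷ []) = []
  dropLast {suc n} (b ∷ v)  = b ∷ dropLast v

  lastBit-⊕ : ∀ {n} (v w : 𝔽₂^ (suc n)) → lastBit (v ⊕ w) ≡ lastBit v xor lastBit w
  lastBit-⊕ {zero}  (a ∷ []) (b ∷ []) = ≡.refl
  lastBit-⊕ {suc n} (a ∷ v)  (b ∷ w)  = lastBit-⊕ v w

  dropLast-⊕ : ∀ {n} (v w : 𝔽₂^ (suc n)) → dropLast (v ⊕ w) ≡ dropLast v ⊕ dropLast w
  dropLast-⊕ {zero}  (a ∷ []) (b ∷ []) = ≡.refl
  dropLast-⊕ {suc n} (a ∷ v)  (b ∷ w)  = ≡.cong (_ ∷_) (dropLast-⊕ v w)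

  rotate : V → V
  rotate v = lastBit v ∷ dropLast v

  rotate-⊕ : Additive rotate
  rotate-⊕ v w = ≡.cong₂ _∷_ (lastBit-⊕ v w) (dropLast-⊕ v w)

  e₀ : V
  e₀ = true ∷ 𝟎

  -- Multiplication by the polynomial with coefficient list f, by Horner's rule with `rotate` as x.
  -- Lists may be longer than the ring's dimension, as reduction modulo x ^ N - 1 is built into the
  -- rotation.
  act : List Bool → V → V
  act []      v = 𝟎
  act (c ∷ f) v = c · v ⊕ rotate (act f v)

  act-⊕ : ∀ f → Additive (act f)
  act-⊕ []      u v = ≡.sym (⊕-identityʳ 𝟎)
  act-⊕ (c ∷ f) u v = begin
    c · (u ⊕ v) ⊕ rotate (act f (u ⊕ v))
      ≡⟨ ≡.cong₂ _⊕_ (·-⊕ c u v) (≡.trans (≡.cong rotate (act-⊕ f u v)) (rotate-⊕ _ _)) ⟩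
    (c · u ⊕ c · v) ⊕ (rotate (act f u) ⊕ rotate (act f v))
      ≡⟨ ⊕-interchange _ _ _ _ ⟩
    (c · u ⊕ rotate (act f u)) ⊕ (c · v ⊕ rotate (act f v)) ∎

  act-rotate : ∀ f v → act f (rotate v) ≡ rotate (act f v)
  act-rotate []      v = ≡.sym (additive-𝟎 rotate rotate-⊕)
  act-rotate (c ∷ f) v = begin
    c · rotate v ⊕ rotate (act f (rotate v))
      ≡⟨ ≡.cong₂ _⊕_ (≡.sym (additive-· rotate rotate-⊕ c v)) (≡.cong rotate (act-rotate f v)) ⟩
    rotate (c · v) ⊕ rotate (rotate (act f v)) ≡⟨ rotate-⊕ _ _ ⟨
    rotate (c · v ⊕ rotate (act f v))          ∎

  -- Both operators are polynomials in the single operator `rotate`.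
  act-comm : ∀ f g v → act f (act g v) ≡ act g (act f v)
  act-comm []      g v = ≡.sym (additive-𝟎 (act g) (act-⊕ g))
  act-comm (c ∷ f) g v = begin
    c · act g v ⊕ rotate (act f (act g v))
      ≡⟨ ≡.cong₂ _⊕_ (≡.sym (additive-· (act g) (act-⊕ g) c v)) (≡.cong rotate (act-comm f g v)) ⟩
    act g (c · v) ⊕ rotate (act g (act f v)) ≡⟨ ≡.cong (act g (c · v) ⊕_) (act-rotate g _) ⟨
    act g (c · v) ⊕ act g (rotate (act f v)) ≡⟨ act-⊕ g _ _ ⟨
    act g (c · v ⊕ rotate (act f v))         ∎

  pad-lastBit : ∀ n f → length f ≤ n → lastBit (pad (suc n) f) ≡ false
  pad-lastBit zero    []      z≤n     = ≡.refl
  pad-lastBit (suc n) []      z≤n     = pad-lastBit n [] z≤n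
  pad-lastBit (suc n) (c ∷ f) (s≤s l) = pad-lastBit n f l

  pad-dropLast : ∀ n f → dropLast (pad (suc n) f) ≡ pad n f
  pad-dropLast zero    []      = ≡.refl
  pad-dropLast zero    (c ∷ f) = ≡.refl
  pad-dropLast (suc n) []      = ≡.cong (false ∷_) (pad-dropLast n [])
  pad-dropLast (suc n) (c ∷ f) = ≡.cong (c ∷_) (pad-dropLast n f)

  -- With at most N coefficients nothing wraps around: each rotation brings a zero to the front.
  act-e₀ : ∀ f → length f ≤ suc D → act f e₀ ≡ pad (suc D) f
  act-e₀ []      _       = ≡.sym (pad-[] (suc D))
  act-e₀ (c ∷ f) (s≤s l) = begin
    c · e₀ ⊕ rotate (act f e₀)        ≡⟨ ≡.cong (λ v → c · e₀ ⊕ rotate v) (act-e₀ f (ℕₚ.m≤n⇒m≤1+n l)) ⟩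
    c · e₀ ⊕ rotate (pad (suc D) f)
      ≡⟨ ≡.cong (c · e₀ ⊕_) (≡.cong₂ _∷_ (pad-lastBit D f l) (pad-dropLast D f)) ⟩
    c · e₀ ⊕ (false ∷ pad D f)        ≡⟨ prepend c ⟩
    c ∷ pad D f                       ∎
    where
    prepend : ∀ c → c · e₀ ⊕ (false ∷ pad D f) ≡ c ∷ pad D f
    prepend false = ≡.trans (≡.cong (_⊕ (false ∷ pad D f)) (false· e₀)) (⊕-identityˡ _)
    prepend true  = ≡.trans (≡.cong (_⊕ (false ∷ pad D f)) (true· e₀))
                            (≡.cong (true ∷_) (⊕-identityˡ _))

  act-toList-e₀ : ∀ a → act (toList a) e₀ ≡ a
  act-toList-e₀ a = ≡.trans
    (act-e₀ (toList a) (ℕₚ.≤-reflexive (Vecₚ.length-toList a))) (pad-toList a)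

  infixl 7 _⊛_

  _⊛_ : V → V → V
  a ⊛ b = act (toList a) b

  -- Every vector is its own action on `e₀`, so commutativity of the product reduces to that of the
  -- operators.
  ⊛-comm : ∀ a b → a ⊛ b ≡ b ⊛ a
  ⊛-comm a b = begin
    act (toList a) b                   ≡⟨ ≡.cong (act (toList a)) (act-toList-e₀ b) ⟨
    act (toList a) (act (toList b) e₀) ≡⟨ act-comm (toList a) (toList b) e₀ ⟩
    act (toList b) (act (toList a) e₀) ≡⟨ ≡.cong (act (toList b)) (act-toList-e₀ a) ⟩
    act (toList b) a                   ∎

  ⊛-assoc : ∀ a b c → (a ⊛ b) ⊛ c ≡ a ⊛ (b ⊛ c)
  ⊛-assoc a b c = begin
    (a ⊛ b) ⊛ c ≡⟨ ⊛-comm (a ⊛ b) c ⟩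
    c ⊛ (a ⊛ b) ≡⟨ act-comm (toList c) (toList a) b ⟩
    a ⊛ (c ⊛ b) ≡⟨ ≡.cong (a ⊛_) (⊛-comm c b) ⟩
    a ⊛ (b ⊛ c) ∎

  ⊛-identityʳ : ∀ a → a ⊛ e₀ ≡ a
  ⊛-identityʳ = act-toList-e₀

  ⊛-distribˡ : ∀ a b c → a ⊛ (b ⊕ c) ≡ a ⊛ b ⊕ a ⊛ c
  ⊛-distribˡ a = act-⊕ (toList a)

  cyclicRing : CommutativeRing 0ℓ 0ℓ
  cyclicRing = record
    { Carrier = V ; _≈_ = _≡_ ; _+_ = _⊕_ ; _*_ = _⊛_ ; -_ = λ v → v ; 0# = 𝟎 ; 1# = e₀
    ; isCommutativeRing = record
      { isRing = record
        { +-isAbelianGroup = record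
          { isGroup = record
            { isMonoid = record
              { isSemigroup = record
                { isMagma = record { isEquivalence = ≡.isEquivalence ; ∙-cong = ≡.cong₂ _⊕_ }
                ; assoc = ⊕-assoc
                }
              ; identity = ⊕-identityˡ , ⊕-identityʳ
              }
            ; inverse = ⊕-self , ⊕-self
            ; ⁻¹-cong = λ eq → eq
            }
          ; comm = ⊕-comm
          }
        ; *-cong = ≡.cong₂ _⊛_
        ; *-assoc = ⊛-assoc
        ; *-identity = (λ a → ≡.trans (⊛-comm e₀ a) (⊛-identityʳ a)) , ⊛-identityʳ
        ; distrib = ⊛-distribˡ , λ a b c → ≡.trans (⊛-comm (b ⊕ c) a) (≡.trans (⊛-distribˡ a b c)
            (≡.cong₂ _⊕_ (⊛-comm a b) (⊛-comm a c)))
        }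
      ; *-comm = ⊛-comm
      }
    }

  open CharacteristicTwo cyclicRing (⊕-self e₀)

  x : V
  x = rotate e₀

  x⊛ : ∀ v → x ⊛ v ≡ rotate v
  x⊛ v = begin
    x ⊛ v         ≡⟨ ⊛-comm x v ⟩
    v ⊛ x         ≡⟨ act-rotate (toList v) e₀ ⟩
    rotate (v ⊛ e₀) ≡⟨ ≡.cong rotate (⊛-identityʳ v) ⟩
    rotate v      ∎

  eval-x : ∀ f → eval f x ≡ act f e₀
  eval-x []      = ≡.refl
  eval-x (c ∷ f) = ≡.cong₂ _⊕_ (bit≡ c) (≡.trans (x⊛ (eval f x)) (≡.cong rotate (eval-x f)))
    where
    bit≡ : ∀ c → bit c ≡ c · e₀
    bit≡ false = ≡.sym (false· e₀)
    bit≡ true  = ≡.sym (true· e₀)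

  x^_ : ℕ → V
  x^ zero  = e₀
  x^ suc i = rotate (x^ i)

  x^-+ : ∀ i j → x^ (i ℕ.+ j) ≡ (x^ i) ⊛ (x^ j)
  x^-+ zero    j = ≡.sym (≡.trans (⊛-comm e₀ (x^ j)) (⊛-identityʳ _))
  x^-+ (suc i) j = begin
    rotate (x^ (i ℕ.+ j))      ≡⟨ ≡.cong rotate (x^-+ i j) ⟩
    rotate ((x^ i) ⊛ (x^ j))   ≡⟨ x⊛ _ ⟨
    x ⊛ ((x^ i) ⊛ (x^ j))      ≡⟨ ⊛-assoc x (x^ i) (x^ j) ⟨
    (x ⊛ (x^ i)) ⊛ (x^ j)      ≡⟨ ≡.cong (_⊛ (x^ j)) (x⊛ (x^ i)) ⟩
    rotate (x^ i) ⊛ (x^ j)     ∎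

  frob-x : ∀ i → frob i x ≡ x^ (2 ℕ.^ i)
  frob-x zero    = ≡.refl
  frob-x (suc i) = begin
    frob i x ⊛ frob i x                ≡⟨ ≡.cong₂ _⊛_ (frob-x i) (frob-x i) ⟩
    (x^ (2 ℕ.^ i)) ⊛ (x^ (2 ℕ.^ i))    ≡⟨ x^-+ (2 ℕ.^ i) (2 ℕ.^ i) ⟨
    x^ (2 ℕ.^ i ℕ.+ 2 ℕ.^ i)
      ≡⟨ ≡.cong (λ j → x^ (2 ℕ.^ i ℕ.+ j)) (≡.sym (ℕₚ.+-identityʳ (2 ℕ.^ i))) ⟩
    x^ (2 ℕ.^ suc i)                   ∎

  monomial : ℕ → List Bool
  monomial i = replicate i false ∷ʳ true

  x^-act : ∀ i → x^ i ≡ act (monomial i) e₀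
  x^-act zero    = ≡.sym (≡.trans (≡.cong₂ _⊕_ (true· e₀) (additive-𝟎 rotate rotate-⊕)) (⊕-identityʳ e₀))
  x^-act (suc i) = ≡.sym (≡.trans
    (≡.cong₂ _⊕_ (false· e₀) (≡.cong rotate (≡.sym (x^-act i)))) (⊕-identityˡ _))

  length-monomial : ∀ i → length (monomial i) ≡ suc i
  length-monomial zero    = ≡.refl
  length-monomial (suc i) = ≡.cong suc (length-monomial i)

  rotate-top : ∀ n → lastBit (pad (suc n) (monomial n)) ≡ true ×
                     dropLast (pad (suc n) (monomial n)) ≡ 𝟎
  rotate-top zero    = ≡.refl , ≡.refl
  rotate-top (suc n) with rotate-top n
  ... | p , q = p , ≡.cong (false ∷_) q

  -- The power x ^ D has its only 1 in the last place, and one more rotation moves it to the front.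
  x^N : x^ (suc D) ≡ e₀
  x^N = begin
    rotate (x^ D)                        ≡⟨ ≡.cong rotate (x^-act D) ⟩
    rotate (act (monomial D) e₀)
      ≡⟨ ≡.cong rotate (act-e₀ (monomial D) (ℕₚ.≤-reflexive (length-monomial D))) ⟩
    rotate (pad (suc D) (monomial D))    ≡⟨ ≡.cong₂ _∷_ (proj₁ (rotate-top D)) (proj₂ (rotate-top D)) ⟩
    e₀                                   ∎

  -- Since 2 ^ m = N + 1, Frobenius `frob m` fixes x, hence every polynomial in x with coefficients
  -- 0 and 1, and every element is one.
  frob-period : ∀ m → 2 ℕ.^ m ≡ 2 ℕ.+ D → ∀ r → frob m r ≡ r
  frob-period m eq r = begin
    frob m r                     ≡⟨ ≡.cong (frob m) (r≡eval r) ⟩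
    frob m (eval (toList r) x)   ≡⟨ frob-eval m (toList r) x ⟩
    eval (toList r) (frob m x)   ≡⟨ ≡.cong (eval (toList r)) (frob-x m) ⟩
    eval (toList r) (x^ (2 ℕ.^ m)) ≡⟨ ≡.cong (λ i → eval (toList r) (x^ i)) eq ⟩
    eval (toList r) (rotate (x^ (suc D))) ≡⟨ ≡.cong (λ v → eval (toList r) (rotate v)) x^N ⟩
    eval (toList r) x            ≡⟨ r≡eval r ⟨
    r                            ∎
    where
    r≡eval : ∀ r → r ≡ eval (toList r) x
    r≡eval r = ≡.sym (≡.trans (eval-x (toList r)) (act-toList-e₀ r))

  -- Up to degree D the value at x is just the coefficient vector, which contains the leading 1.
  monic-at-x≢𝟎 : ∀ {d f} → Monic Bit d f → d ≤ D → f x ≢ 𝟎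
  monic-at-x≢𝟎 {d} {f} F d≤D fx≡𝟎 with monic-bits⇒eval F
  ... | l , ≡.refl , f≈ = pad-∷ʳ-true (suc D) l (s≤s d≤D) (begin
    pad (suc D) (l ∷ʳ true)  ≡⟨ act-e₀ (l ∷ʳ true) (≡.subst (_≤ suc D)
                                  (≡.sym (Listₚ.length-++-comm l (true ∷ []))) (s≤s d≤D)) ⟨
    act (l ∷ʳ true) e₀       ≡⟨ eval-x (l ∷ʳ true) ⟨
    eval (l ∷ʳ true) x       ≡⟨ f≈ x ⟨
    f x                      ≡⟨ fx≡𝟎 ⟩
    𝟎                        ∎)

module _ (j : ℕ) where
  private
    D : ℕ
    D = geometric j

  open CyclicRing D
  private
    module R = CommutativeRing cyclicRing
    module CR = CharacteristicTwo cyclicRing (⊕-self e₀)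
  open CR using (differences; monic-differences; differences-factor; frob-period⇒regular)
  open ≡.≡-Reasoning

  private
    L : 𝔽₂^ (suc D)
    L = differences j x

  cyclicRing-period : ∀ r → CR.frob (suc j) r ≡ r
  cyclicRing-period = frob-period (suc j) (≡.sym (geometric-sum j))

  cyclicRing-regular : ∀ r → ∃[ s ] r ⊛ (r ⊛ s) ≡ r
  cyclicRing-regular = frob-period⇒regular j cyclicRing-period

  open FieldQuotient cyclicRing _≟ᵛ_ cyclicRing-regular

  quotientField : ∀ {μ} → μ ≢ 𝟎 → (∃[ w ] μ ≡ L ⊛ w) →
    All (λ v → μ ⊛ v ≡ 𝟎 ⊎ ∃[ s ] μ ⊛ (v ⊛ s) ≡ μ) (allVectors (suc D)) →
    InterpolatingFamily (suc j)
  quotientField {μ} μ≢𝟎 (w , μ≡Lw) units = quadratics nontrivial zero-or-unit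
      (λ a b → (μ ⊛ a) ≟ᵛ (μ ⊛ b)) (suc j) (s≤s z≤n)
      (λ z → ≡.cong (μ ⊛_) (≡.trans (frob-agree (suc j) z) (cyclicRing-period z)))
      x x-primitive
    where
    open QuotientByAnnihilator cyclicRing μ
    open FiniteField quotient (≡.cong (μ ⊛_) (⊕-self e₀))
    module CK = CharacteristicTwo quotient (≡.cong (μ ⊛_) (⊕-self e₀))

    frob-agree : ∀ i z → CK.frob i z ≡ CR.frob i z
    frob-agree zero    z = ≡.refl
    frob-agree (suc i) z = ≡.cong₂ _⊛_ (frob-agree i z) (frob-agree i z)

    nontrivial : μ ⊛ e₀ ≢ μ ⊛ 𝟎
    nontrivial eq = μ≢𝟎 (≡.trans (≡.sym (R.*-identityʳ μ)) (≡.trans eq (R.zeroʳ μ)))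

    zero-or-unit : ∀ v → μ ⊛ v ≡ μ ⊛ 𝟎 ⊎ ∃[ s ] μ ⊛ (v ⊛ s) ≡ μ ⊛ e₀
    zero-or-unit v with All.lookup units (∈-allVectors v)
    ... | inj₁ μv≡𝟎     = inj₁ (≡.trans μv≡𝟎 (≡.sym (R.zeroʳ μ)))
    ... | inj₂ (s , eq) = inj₂ (s , ≡.trans eq (≡.sym (R.*-identityʳ μ)))

    -- If frob d x = x in R / Ann μ then μ kills L; but μ is a multiple of L and L is regular.
    x-primitive : ∀ d → 1 ≤ d → d < suc j → ¬ μ ⊛ CK.frob d x ≡ μ ⊛ x
    x-primitive d 1≤d (s≤s d≤j) eq =
      μ≢𝟎 (annihilates-factor⇒≈0 μ≡Lw (μL≡𝟎 (differences-factor 1≤d d≤j x)))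
      where
      μL≡𝟎 : ∃[ t ] L ≡ (CR.frob d x ⊕ x) ⊛ t → μ ⊛ L ≡ 𝟎
      μL≡𝟎 (t , L≡) = begin
        μ ⊛ L                             ≡⟨ ≡.cong (μ ⊛_) L≡ ⟩
        μ ⊛ ((CR.frob d x ⊕ x) ⊛ t)       ≡⟨ R.*-assoc μ _ t ⟨
        μ ⊛ (CR.frob d x ⊕ x) ⊛ t         ≡⟨ ≡.cong (_⊛ t) (R.distribˡ μ _ x) ⟩
        (μ ⊛ CR.frob d x ⊕ μ ⊛ x) ⊛ t     ≡⟨ ≡.cong (λ z → (μ ⊛ z ⊕ μ ⊛ x) ⊛ t) (frob-agree d x) ⟨
        (μ ⊛ CK.frob d x ⊕ μ ⊛ x) ⊛ t     ≡⟨ ≡.cong (λ z → (z ⊕ μ ⊛ x) ⊛ t) eq ⟩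
        (μ ⊛ x ⊕ μ ⊛ x) ⊛ t               ≡⟨ ≡.cong (_⊛ t) (⊕-self (μ ⊛ x)) ⟩
        𝟎 ⊛ t                             ≡⟨ R.zeroˡ t ⟩
        𝟎                                 ∎

  interpolatingFamily : InterpolatingFamily (suc j)
  interpolatingFamily =
    let μ , μ≢𝟎 , multiple , units = maximal-annihilator (allVectors (suc D)) L
          -- The degree of `L` is exactly D, the largest degree that escapes reduction.
          (monic-at-x≢𝟎 (monic-differences j) ℕₚ.≤-refl)
    in  quotientField μ≢𝟎 multiple units

-- Covering designs as lists of bases

open import Data.Nat using (_+_; _*_; _∸_; _^_)

least : ∀ {P : Pred ℕ 0ℓ} → Decidable P → ∀ {n} → P n →
        ∃[ m ] (P m × m ≤ n × (∀ {j} → P j → m ≤ j))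
least P? {n} p with P? 0
least P? {n}     p | yes p₀ = 0 , p₀ , z≤n , λ _ → z≤n
least P? {zero}  p | no ¬p₀ = ⊥-elim (¬p₀ p)
least P? {suc n} p | no ¬p₀ with least (P? ∘ suc) p
... | m , pm , m≤n , min = suc m , pm , s≤s m≤n , λ
  { {zero} p₀ → ⊥-elim (¬p₀ p₀) ; {suc j} pj → s≤s (min pj) }

-- Counting arguments.

lookup-injective : ∀ {A : Set} {xs : List A} → AllPairs _≢_ xs →
                   ∀ {i j} → lookup xs i ≡ lookup xs j → i ≡ j
lookup-injective (x# ∷ xs#) {zero}  {zero}  eq = ≡.refl
lookup-injective (x# ∷ xs#) {zero}  {suc j} eq = ⊥-elim (All.lookup x# (∈ₚ.∈-lookup j) eq)
lookup-injective (x# ∷ xs#) {suc i} {zero}  eq = ⊥-elim (All.lookup x# (∈ₚ.∈-lookup i) (≡.sym eq))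
lookup-injective (x# ∷ xs#) {suc i} {suc j} eq = ≡.cong suc (lookup-injective xs# eq)

-- Pigeonhole: sending each entry to its position in `allVectors n` is injective.
distinct⇒length≤2^n : ∀ {n} {xs : List (𝔽₂^ n)} → AllPairs _≢_ xs → length xs ≤ 2 ^ n
distinct⇒length≤2^n {n} {xs} xs# = ≡.subst (length xs ≤_) (length-allVectors n)
  (Finₚ.injective⇒≤ {f = λ i → Any.index (∈-allVectors (lookup xs i))} λ {i} {j} eq →
    lookup-injective xs# (begin
      lookup xs i ≡⟨ Anyₚ.lookup-index (∈-allVectors (lookup xs i)) ⟩
      lookup (allVectors n) (Any.index (∈-allVectors (lookup xs i)))
        ≡⟨ ≡.cong (lookup (allVectors n)) eq ⟩
      lookup (allVectors n) (Any.index (∈-allVectors (lookup xs j)))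
        ≡⟨ Anyₚ.lookup-index (∈-allVectors (lookup xs j)) ⟨
      lookup xs j ∎))
  where open ≡.≡-Reasoning

module _ {a b} (f : 𝔽₂^ a → 𝔽₂^ b) (f-injective : ∀ {u v} → f u ≡ f v → u ≡ v) where

  private
    values : List (𝔽₂^ b)
    values = map f (allVectors a)

    values# : AllPairs _≢_ values
    values# = AllPairsₚ.map⁺ (AllPairs.map (_∘ f-injective) (allVectors-distinct a))

    length-values : length values ≡ 2 ^ a
    length-values = ≡.trans (Listₚ.length-map f (allVectors a)) (length-allVectors a)

  injective⇒2^≤ : 2 ^ a ≤ 2 ^ b
  injective⇒2^≤ = ≡.subst (_≤ 2 ^ b) length-values (distinct⇒length≤2^n values#)

  -- A missed value together with the 2 ^ a values of `f` would be more than 2 ^ b distinct vectors.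
  injective⇒surjective : b ≤ a → ∀ y → ∃[ x ] f x ≡ y
  injective⇒surjective b≤a y with ∃-dec (λ x → f x ≟ᵛ y)
  ... | yes found = found
  ... | no  ∄x    = ⊥-elim (ℕₚ.<⇒≱
    (≡.subst (_≤ 2 ^ b) (≡.cong suc length-values) (distinct⇒length≤2^n
      (Allₚ.map⁺ (All.universal (λ x eq → ∄x (x , ≡.sym eq)) _) ∷ values#)))
    (ℕₚ.^-monoʳ-≤ 2 b≤a))

-- Linear combinations, spans and covering conditions.

xor-· : ∀ {n} a b (v : 𝔽₂^ n) → (a xor b) · v ≡ a · v ⊕ b · v
xor-· false b     v = ≡.sym (≡.trans (≡.cong (_⊕ b · v) (false· v)) (⊕-identityˡ _))
xor-· true  false v = ≡.trans (true· v) (≡.sym (≡.trans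
  (≡.cong₂ _⊕_ (true· v) (false· v)) (⊕-identityʳ v)))
xor-· true  true  v = ≡.trans (false· v) (≡.sym (⊕-self (true · v)))

linComb-⊕ : ∀ {n d} (vs : Vec (𝔽₂^ n) d) → Additive (λ as → linComb as vs)
linComb-⊕ []       []       []       = ≡.sym (⊕-identityʳ 𝟎)
linComb-⊕ (v ∷ vs) (a ∷ as) (b ∷ bs) = ≡.trans
  (≡.cong₂ _⊕_ (xor-· a b v) (linComb-⊕ vs as bs)) (⊕-interchange _ _ _ _)

linComb-false : ∀ {n d} as v (vs : Vec (𝔽₂^ n) d) → linComb (false ∷ as) (v ∷ vs) ≡ linComb as vs
linComb-false as v vs = ≡.trans (≡.cong (_⊕ linComb as vs) (false· v)) (⊕-identityˡ _)

linComb-true : ∀ {n d} as v (vs : Vec (𝔽₂^ n) d) → linComb (true ∷ as) (v ∷ vs) ≡ v ⊕ linComb as vs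
linComb-true as v vs = ≡.cong (_⊕ linComb as vs) (true· v)

linComb-𝟎 : ∀ {n d} (vs : Vec (𝔽₂^ n) d) → linComb 𝟎 vs ≡ 𝟎
linComb-𝟎 vs = additive-𝟎 (λ as → linComb as vs) (linComb-⊕ vs)

linComb-injective : ∀ {n d} (vs : Vec (𝔽₂^ n) d) → LinearlyIndependent vs →
                    ∀ {as bs} → linComb as vs ≡ linComb bs vs → as ≡ bs
linComb-injective vs indep {as} {bs} eq = ⊕≡𝟎⇒≡ (indep (as ⊕ bs) (≡.trans (linComb-⊕ vs as bs)
  (≡.trans (≡.cong (_⊕ linComb bs vs) eq) (⊕-self _))))

linComb-closed : ∀ {n d} (X : Subspace n) {vs : Vec (𝔽₂^ n) d} → Allᵛ (_∈ X) vs →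
                 ∀ as → linComb as vs ∈ X
linComb-closed X []       []       = Subspace.𝟎-closed X
linComb-closed X (p ∷ ps) (a ∷ as) =
  Subspace.⊕-closed X (Subspace.·-closed X a p) (linComb-closed X ps as)

InSpan : ∀ {n d} → Vec (𝔽₂^ n) d → 𝔽₂^ n → Set
InSpan vs v = ∃[ as ] linComb as vs ≡ v

InSpan? : ∀ {n d} (vs : Vec (𝔽₂^ n) d) → Decidable (InSpan vs)
InSpan? vs v = ∃-dec (λ as → linComb as vs ≟ᵛ v)

generators-InSpan : ∀ {n d} (vs : Vec (𝔽₂^ n) d) → Allᵛ (InSpan vs) vs
generators-InSpan []       = []
generators-InSpan (v ∷ vs) =
  (true ∷ 𝟎 , ≡.trans (linComb-true 𝟎 v vs)
    (≡.trans (≡.cong (v ⊕_) (linComb-𝟎 vs)) (⊕-identityʳ v))) ∷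
  Allᵛ.map (λ (as , eq) → false ∷ as , ≡.trans (linComb-false as v vs) eq)
    (generators-InSpan vs)

span : ∀ {n d} → Vec (𝔽₂^ n) d → Subspace n
span vs = record
  { χ        = λ v → ⌊ InSpan? vs v ⌋
  ; 𝟎-closed = fromWitness (𝟎 , linComb-𝟎 vs)
  ; ⊕-closed = λ p q → let (as , eq) = toWitness p ; (bs , eq′) = toWitness q in
      fromWitness (as ⊕ bs , ≡.trans (linComb-⊕ vs as bs) (≡.cong₂ _⊕_ eq eq′))
  ; ·-closed = λ a p → let (as , eq) = toWitness p in
      fromWitness (a · as , ≡.trans (additive-· (λ as → linComb as vs) (linComb-⊕ vs) a as)
        (≡.cong (a ·_) eq))
  }

span-basis : ∀ {n d} {vs : Vec (𝔽₂^ n) d} → LinearlyIndependent vs → IsBasis vs (span vs)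
span-basis {vs = vs} indep = record
  { members = Allᵛ.map fromWitness (generators-InSpan vs)
  ; independent = indep
  ; spanning = λ v → toWitness
  }

-- Over 𝔽₂ this is linear independence: the only possible relations are y = 0, z = 0 and y + z = 0.
IndependentPair : ∀ {n} → 𝔽₂^ n → 𝔽₂^ n → Set
IndependentPair y z = y ≢ 𝟎 × z ≢ 𝟎 × y ≢ z

independentPair? : ∀ {n} (y z : 𝔽₂^ n) → Dec (IndependentPair y z)
independentPair? y z = ¬? (y ≟ᵛ 𝟎) ×-dec (¬? (z ≟ᵛ 𝟎) ×-dec ¬? (y ≟ᵛ z))

module _ {n} (y z : 𝔽₂^ n) where

  private
    comb-ft : linComb (false ∷ true ∷ []) (y ∷ z ∷ []) ≡ z
    comb-ft = ≡.trans (linComb-false (true ∷ []) y (z ∷ []))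
           (≡.trans (linComb-true [] z []) (⊕-identityʳ z))

    comb-tf : linComb (true ∷ false ∷ []) (y ∷ z ∷ []) ≡ y
    comb-tf = ≡.trans (linComb-true (false ∷ []) y (z ∷ []))
           (≡.trans (≡.cong (y ⊕_) (linComb-false [] z [])) (⊕-identityʳ y))

    comb-tt : linComb (true ∷ true ∷ []) (y ∷ z ∷ []) ≡ y ⊕ z
    comb-tt = ≡.trans (linComb-true (true ∷ []) y (z ∷ []))
           (≡.cong (y ⊕_) (≡.trans (linComb-true [] z []) (⊕-identityʳ z)))

  independent⇒pair : LinearlyIndependent (y ∷ z ∷ []) → IndependentPair y z
  independent⇒pair indep =
    (λ y≡𝟎 → case (indep _ (≡.trans comb-tf y≡𝟎))) ,
    (λ z≡𝟎 → case′ (indep _ (≡.trans comb-ft z≡𝟎))) ,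
    (λ y≡z → case (indep _ (≡.trans comb-tt (≡.trans (≡.cong (_⊕ z) y≡z) (⊕-self z)))))
    where
    case : ∀ {b} → true ∷ b ∷ [] ≢ 𝟎
    case ()
    case′ : ∀ {b} → b ∷ true ∷ [] ≢ 𝟎
    case′ ()

  pair⇒independent : IndependentPair y z → LinearlyIndependent (y ∷ z ∷ [])
  pair⇒independent (y≢𝟎 , z≢𝟎 , y≢z) = λ
    { (false ∷ false ∷ []) eq → ≡.refl
    ; (false ∷ true  ∷ []) eq → ⊥-elim (z≢𝟎 (≡.trans (≡.sym comb-ft) eq))
    ; (true  ∷ false ∷ []) eq → ⊥-elim (y≢𝟎 (≡.trans (≡.sym comb-tf) eq))
    ; (true  ∷ true  ∷ []) eq → ⊥-elim (y≢z (⊕≡𝟎⇒≡ (≡.trans (≡.sym comb-tt) eq)))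
    }

SpansPair : ∀ {n k} → 𝔽₂^ n → 𝔽₂^ n → Vec (𝔽₂^ n) k → Set
SpansPair y z vs = InSpan vs y × InSpan vs z

-- Bases replace blocks and independent pairs replace planes. The condition then concerns finite
-- data and can be decided by search; repeated blocks are allowed.
record CoveringBases {n k} (bs : List (Vec (𝔽₂^ n) k)) : Set where
  constructor coveringBases
  field
    independent : All LinearlyIndependent bs
    covering    : ∀ y z → IndependentPair y z → Any (SpansPair y z) bs

coveringBases? : ∀ {n k} → Decidable (CoveringBases {n} {k})
coveringBases? bs = map′ (λ (p , q) → coveringBases p q)
  (λ (coveringBases p q) → p , q)
  (All.all? (λ vs → ∀-dec (λ as → (linComb as vs ≟ᵛ 𝟎) →-dec (as ≟ᵛ 𝟎))) bs
   ×-dec ∀-dec (λ y → ∀-dec (λ z → independentPair? y z →-dec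
           Any.any? (λ vs → InSpan? vs y ×-dec InSpan? vs z) bs)))

infix 4 _≐?_

_≐?_ : ∀ {n} (X Y : Subspace n) → Dec (X ≐ Y)
X ≐? Y = (X ⊆? Y) ×-dec (Y ⊆? X)

subspaceDecSetoid : ℕ → DecSetoid 0ℓ 0ℓ
subspaceDecSetoid n = record
  { Carrier = Subspace n
  ; _≈_ = _≐_
  ; isDecEquivalence = record
    { isEquivalence = Setoid.isEquivalence (subspaceSetoid n)
    ; _≟_ = _≐?_
    }
  }

-- Different bases may span the same block, so removing duplicates gives only an inequality.
bases⇒design : ∀ {n k} {bs : List (Vec (𝔽₂^ n) k)} → CoveringBases bs →
               ∃[ 𝕊 ] ∣_∣ {n} {k} {2} 𝕊 ≤ length bs
bases⇒design {n} {k} {bs} (coveringBases indep cov) =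
  record
    { blocks   = deduplicate _≐?_ (map span bs)
    ; distinct = Uniqueₚ.deduplicate-! (subspaceDecSetoid n) (map span bs)
    ; dims     = Allₚ.deduplicate⁺ _≐?_ (Allₚ.map⁺ (All.map (λ i → _ , span-basis i) indep))
    ; covers   = λ Y Y-dim → Anyₚ.deduplicate⁺ _≐?_
        (λ (_ , X⊆Z) Y⊆X v v∈Y → X⊆Z v (Y⊆X v v∈Y)) (Anyₚ.map⁺ (covers′ Y Y-dim))
    } ,
  ℕₚ.≤-trans (Listₚ.length-deduplicate _≐?_ (map span bs)) (ℕₚ.≤-reflexive (Listₚ.length-map span bs))
  where
  covers′ : ∀ Y → HasDim Y 2 → Any (λ vs → Y ⊆ span vs) bs
  covers′ Y (y ∷ z ∷ [] , basis) = Any.map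
    (λ {vs} (y∈ , z∈) v v∈Y → let (as , eq) = IsBasis.spanning basis v v∈Y in
      ≡.subst (_∈ span vs) eq
        (linComb-closed (span vs) (fromWitness y∈ ∷ fromWitness z∈ ∷ []) as))
    (cov y z (independent⇒pair y z (IsBasis.independent basis)))

bases : ∀ {n k} {Xs : List (Subspace n)} → All (λ X → HasDim X k) Xs → List (Vec (𝔽₂^ n) k)
bases []              = []
bases ((vs , _) ∷ ds) = vs ∷ bases ds

length-bases : ∀ {n k} {Xs : List (Subspace n)} (ds : All (λ X → HasDim X k) Xs) →
               length (bases ds) ≡ length Xs
length-bases []       = ≡.refl
length-bases (_ ∷ ds) = ≡.cong suc (length-bases ds)

bases-independent : ∀ {n k} {Xs : List (Subspace n)} (ds : All (λ X → HasDim X k) Xs) →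
                    All LinearlyIndependent (bases ds)
bases-independent []                 = []
bases-independent ((_ , basis) ∷ ds) = IsBasis.independent basis ∷ bases-independent ds

design-contains : ∀ {n k} (𝕊 : CoveringDesign n k 2) {y z} → IndependentPair y z →
                  Any (λ X → y ∈ X × z ∈ X) (blocks 𝕊)
design-contains 𝕊 {y} {z} pair = Any.map
  (λ Y⊆X → Y⊆X y (Allᵛ.head members) , Y⊆X z (Allᵛ.head (Allᵛ.tail members)))
  (covers 𝕊 (span (y ∷ z ∷ [])) (_ , basis))
  where
  basis = span-basis (pair⇒independent y z pair)
  open IsBasis basis

bases-covering : ∀ {n k} {Xs : List (Subspace n)} (ds : All (λ X → HasDim X k) Xs) {y z} →
                 Any (λ X → y ∈ X × z ∈ X) Xs → Any (SpansPair y z) (bases ds)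
bases-covering ((_ , basis) ∷ _) (here (y∈ , z∈)) =
  here (IsBasis.spanning basis _ y∈ , IsBasis.spanning basis _ z∈)
bases-covering (_ ∷ ds) (there p) = there (bases-covering ds p)

design⇒bases : ∀ {n k} (𝕊 : CoveringDesign n k 2) → CoveringBases (bases (dims 𝕊))
design⇒bases 𝕊 = coveringBases (bases-independent (dims 𝕊))
  (λ y z pair → bases-covering (dims 𝕊) (design-contains 𝕊 pair))

-- Existence of the covering number.

Attained : ℕ → ℕ → ℕ → Set
Attained n k s = ∃[ Bs ] CoveringBases {n} {k} (toList {n = s} Bs)

attained? : ∀ n k → Decidable (Attained n k)
attained? n k s = search-Vec (search-Vec ∃-dec k) s (λ Bs → coveringBases? (toList Bs))

bases⇒attained : ∀ {n k} {bs : List (Vec (𝔽₂^ n) k)} → CoveringBases bs → Attained n k (length bs)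
bases⇒attained {bs = bs} cov =
  fromList bs , ≡.subst CoveringBases (≡.sym (Vecₚ.toList∘fromList bs)) cov

-- The least attained length m yields a design of size at most m, while the bases of any design show
-- its size to be at least m. Applied to the design found, the second bound makes its size equal to
-- m.
coveringNumber : ∀ {n k} {bs : List (Vec (𝔽₂^ n) k)} → CoveringBases bs →
                 ∃[ m ] (IsCoveringNumber n k 2 m × m ≤ length bs)
coveringNumber {n} {k} cov =
  let m , (Bs , Bs-cov) , m≤ , minimal = least (attained? n k) (bases⇒attained cov)
      𝕊 , ∣𝕊∣≤ = bases⇒design Bs-cov
      lower = λ (𝕋 : CoveringDesign n k 2) → minimal (≡.subst (Attained n k)
                (length-bases (dims 𝕋)) (bases⇒attained (design⇒bases 𝕋)))
  in  m , ((𝕊 , ℕₚ.≤-antisym (≡.subst (∣ 𝕊 ∣ ≤_) (Vecₚ.length-toList Bs) ∣𝕊∣≤) (lower 𝕊)) , lower) , m≤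

-- Blocks as images of linear embeddings

-- Additivity is linearity here, the scalars being 0 and 1. Blocks given as maps can be moved
-- between spaces by composition.
record Embedding (k n : ℕ) : Set where
  field
    to        : 𝔽₂^ k → 𝔽₂^ n
    additive  : Additive to
    injective : ∀ {u v} → to u ≡ to v → u ≡ v

open Embedding

infixr 9 _∘ᵉ_

_∘ᵉ_ : ∀ {k l n} → Embedding l n → Embedding k l → Embedding k n
f ∘ᵉ g = record
  { to        = to f ∘ to g
  ; additive  = λ u v → ≡.trans (≡.cong (to f) (additive g u v)) (additive f _ _)
  ; injective = injective g ∘ injective f
  }

basisEmbedding : ∀ {n k} (vs : Vec (𝔽₂^ n) k) → LinearlyIndependent vs → Embedding k n
basisEmbedding vs indep = record
  { to        = λ as → linComb as vs
  ; additive  = linComb-⊕ vs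
  ; injective = linComb-injective vs indep
  }

inverseEmbedding : ∀ {a b} → b ≤ a → Embedding a b → Embedding b a
inverseEmbedding b≤a f = record
  { to        = λ y → proj₁ (surj y)
  ; additive  = λ u v → injective f (≡.trans (proj₂ (surj (u ⊕ v)))
      (≡.sym (≡.trans (additive f _ _) (≡.cong₂ _⊕_ (proj₂ (surj u)) (proj₂ (surj v))))))
  ; injective = λ {u} {v} eq → ≡.trans (≡.sym (proj₂ (surj u)))
      (≡.trans (≡.cong (to f) eq) (proj₂ (surj v)))
  }
  where surj = injective⇒surjective (to f) (injective f) b≤a

inverseEmbedding-section : ∀ {a b} (b≤a : b ≤ a) (f : Embedding a b) x →
                           to (inverseEmbedding b≤a f) (to f x) ≡ x
inverseEmbedding-section b≤a f x =
  injective f (proj₂ (injective⇒surjective (to f) (injective f) b≤a (to f x)))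

-- The images of the standard basis vectors.
images : ∀ {n k} → (𝔽₂^ k → 𝔽₂^ n) → Vec (𝔽₂^ n) k
images {k = zero}  f = []
images {k = suc k} f = f (true ∷ 𝟎) ∷ images (f ∘ (false ∷_))

linComb-images : ∀ {n k} (f : 𝔽₂^ k → 𝔽₂^ n) → Additive f → ∀ as → linComb as (images f) ≡ f as
linComb-images f f-⊕ []       = ≡.sym (additive-𝟎 f f-⊕)
linComb-images f f-⊕ (true ∷ as) = begin
  linComb (true ∷ as) (images f) ≡⟨ linComb-true as (f (true ∷ 𝟎)) (images (f ∘ (false ∷_))) ⟩
  f (true ∷ 𝟎) ⊕ linComb as (images (f ∘ (false ∷_)))
    ≡⟨ ≡.cong (f (true ∷ 𝟎) ⊕_) (linComb-images (f ∘ (false ∷_)) (λ u v → f-⊕ _ _) as) ⟩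
  f (true ∷ 𝟎) ⊕ f (false ∷ as) ≡⟨ f-⊕ _ _ ⟨
  f (true ∷ (𝟎 ⊕ as))           ≡⟨ ≡.cong (λ v → f (true ∷ v)) (⊕-identityˡ as) ⟩
  f (true ∷ as)                 ∎
  where open ≡.≡-Reasoning
linComb-images f f-⊕ (false ∷ as) = ≡.trans
  (linComb-false as (f (true ∷ 𝟎)) (images (f ∘ (false ∷_))))
  (linComb-images (f ∘ (false ∷_)) (λ u v → f-⊕ _ _) as)

HitsPair : ∀ {k n} → 𝔽₂^ n → 𝔽₂^ n → Embedding k n → Set
HitsPair y z f = (∃[ u ] to f u ≡ y) × (∃[ u ] to f u ≡ z)

CoveringEmbeddings : ∀ {k n} → List (Embedding k n) → Set
CoveringEmbeddings fs = ∀ y z → IndependentPair y z → Any (HitsPair y z) fs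

embeddings⇒bases : ∀ {k n} {fs : List (Embedding k n)} → CoveringEmbeddings fs →
                   CoveringBases (map (images ∘ to) fs)
embeddings⇒bases cov = coveringBases
  (Allₚ.map⁺ (All.universal (λ f as eq → injective f (≡.trans
    (≡.sym (linComb-images (to f) (additive f) as))
    (≡.trans eq (≡.sym (additive-𝟎 (to f) (additive f)))))) _))
  (λ y z pair → Anyₚ.map⁺ (Any.map
    (λ {f} ((u , eq) , (v , eq′)) →
      (u , ≡.trans (linComb-images (to f) (additive f) u) eq) ,
      (v , ≡.trans (linComb-images (to f) (additive f) v) eq′))
    (cov y z pair)))

pad-⊕ : ∀ {k} m (u v : 𝔽₂^ k) → pad m (toList (u ⊕ v)) ≡ pad m (toList u) ⊕ pad m (toList v)
pad-⊕ zero    u       v       = ≡.refl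
pad-⊕ (suc m) []      []      = ≡.cong (false ∷_) (pad-⊕ m [] [])
pad-⊕ (suc m) (a ∷ u) (b ∷ v) = ≡.cong (_ ∷_) (pad-⊕ m u v)

pad-injective : ∀ {k m} → k ≤ m → {u v : 𝔽₂^ k} → pad m (toList u) ≡ pad m (toList v) → u ≡ v
pad-injective z≤n       {[]}    {[]}    _  = ≡.refl
pad-injective (s≤s k≤m) {a ∷ u} {b ∷ v} eq = ≡.cong₂ _∷_ (Vecₚ.∷-injectiveˡ eq)
  (pad-injective k≤m (Vecₚ.∷-injectiveʳ eq))

-- Appending zeros places 𝔽₂ᵏ inside the field with 2ᵐ elements; k ≤ m amounts to n ≥ 2k.
padEmbedding : ∀ {k m} → k ≤ m → Embedding k m
padEmbedding {m = m} k≤m = record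
  { to = λ u → pad m (toList u) ; additive = pad-⊕ m ; injective = pad-injective k≤m }

graphEmbedding : ∀ {k m} (A : 𝔽₂^ k → 𝔽₂^ m) → Additive A → Embedding k (k + m)
graphEmbedding A A-⊕ = record
  { to        = λ u → u Vec.++ A u
  ; additive  = λ u v → ≡.trans (≡.cong ((u ⊕ v) Vec.++_) (A-⊕ u v))
      (≡.sym (Vecₚ.zipWith-++ _xor_ u (A u) v (A v)))
  ; injective = λ {u} {v} → Vecₚ.++-injectiveˡ u v
  }

-- Parametrises ⟨ u ⟩ × 𝔽₂ᵐ so that first coordinate 0 gives 0 × 𝔽₂ᵐ for every u.
lineEmbedding : ∀ {k m} (u : 𝔽₂^ k) → u ≢ 𝟎 → Embedding (suc m) (k + m)
lineEmbedding {k} {m} u u≢𝟎 = record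
  { to        = λ { (t ∷ w) → t · u Vec.++ w }
  ; additive  = λ { (s ∷ v) (t ∷ w) → ≡.trans (≡.cong (Vec._++ (v ⊕ w)) (xor-· s t u))
                      (≡.sym (Vecₚ.zipWith-++ _xor_ (s · u) v (t · u) w)) }
  ; injective = λ { {s ∷ v} {t ∷ w} eq → ≡.cong₂ _∷_
                      (scalar-injective s t (Vecₚ.++-injectiveˡ (s · u) (t · u) eq))
                      (Vecₚ.++-injectiveʳ (s · u) (t · u) eq) }
  }
  where
  scalar-injective : ∀ s t → s · u ≡ t · u → s ≡ t
  scalar-injective false false eq = ≡.refl
  scalar-injective true  true  eq = ≡.refl
  scalar-injective false true  eq = ⊥-elim (u≢𝟎 (≡.trans (≡.sym (true· u)) (≡.trans (≡.sym eq) (false· u))))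
  scalar-injective true  false eq = ⊥-elim (u≢𝟎 (≡.trans (≡.sym (true· u)) (≡.trans eq (false· u))))

NonzeroVector : ℕ → Set
NonzeroVector k = ∃[ u ] u ≢ 𝟎 {k}

nonzeroVectors : ∀ k → List (NonzeroVector k)
nonzeroVectors zero    = []
nonzeroVectors (suc k) =
  map (λ (u , u≢𝟎) → false ∷ u , u≢𝟎 ∘ Vecₚ.∷-injectiveʳ) (nonzeroVectors k) ++
  map (λ u → true ∷ u , λ ()) (allVectors k)

length-nonzeroVectors : ∀ k → suc (length (nonzeroVectors k)) ≡ 2 ^ k
length-nonzeroVectors zero    = ≡.refl
length-nonzeroVectors (suc k) = begin
  suc (length (nonzeroVectors (suc k)))
    ≡⟨ ≡.cong suc (Listₚ.length-++ (map _ (nonzeroVectors k))) ⟩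
  suc (length (map _ (nonzeroVectors k))) + length (map _ (allVectors k))
    ≡⟨ ≡.cong₂ _+_ (≡.cong suc (Listₚ.length-map _ (nonzeroVectors k))) (Listₚ.length-map _ (allVectors k)) ⟩
  suc (length (nonzeroVectors k)) + length (allVectors k)
    ≡⟨ ≡.cong₂ _+_ (length-nonzeroVectors k) (≡.trans (length-allVectors k) (≡.sym (ℕₚ.+-identityʳ _))) ⟩
  2 ^ suc k ∎
  where open ≡.≡-Reasoning

∈-nonzeroVectors : ∀ {k} (u : 𝔽₂^ k) → u ≢ 𝟎 → Any (λ p → proj₁ p ≡ u) (nonzeroVectors k)
∈-nonzeroVectors []          u≢𝟎 = ⊥-elim (u≢𝟎 ≡.refl)
∈-nonzeroVectors {suc k} (false ∷ u) u≢𝟎 = Anyₚ.++⁺ˡ (Anyₚ.map⁺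
  (Any.map (≡.cong (false ∷_)) (∈-nonzeroVectors u (u≢𝟎 ∘ ≡.cong (false ∷_)))))
∈-nonzeroVectors {suc k} (true ∷ u) u≢𝟎 = Anyₚ.++⁺ʳ (map _ (nonzeroVectors k)) (Anyₚ.map⁺
  (Any.map (λ eq → ≡.cong (true ∷_) (≡.sym eq)) (∈-allVectors u)))

independent-or-collinear : ∀ {k} → NonzeroVector k → (u v : 𝔽₂^ k) → IndependentPair u v ⊎
  ∃[ l ] (l ≢ 𝟎 × ∃[ s ] ∃[ t ] (u ≡ s · l × v ≡ t · l))
independent-or-collinear (l , l≢𝟎) u v with u ≟ᵛ 𝟎 | v ≟ᵛ 𝟎 | u ≟ᵛ v
... | no u≢𝟎   | no v≢𝟎   | no u≢v = inj₁ (u≢𝟎 , v≢𝟎 , u≢v)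
... | no u≢𝟎   | no v≢𝟎   | yes u≡v =
  inj₂ (u , u≢𝟎 , true , true , ≡.sym (true· u) , ≡.trans (≡.sym u≡v) (≡.sym (true· u)))
... | no u≢𝟎   | yes v≡𝟎  | _ =
  inj₂ (u , u≢𝟎 , true , false , ≡.sym (true· u) , ≡.trans v≡𝟎 (≡.sym (false· u)))
... | yes u≡𝟎  | no v≢𝟎   | _ =
  inj₂ (v , v≢𝟎 , false , true , ≡.trans u≡𝟎 (≡.sym (false· v)) , ≡.sym (true· v))
-- Two zero vectors lie on every line, so the supplied nonzero vector serves as the default.
... | yes u≡𝟎  | yes v≡𝟎  | _ =
  inj₂ (l , l≢𝟎 , false , false , ≡.trans u≡𝟎 (≡.sym (false· l)) , ≡.trans v≡𝟎 (≡.sym (false· l)))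

length-cartesianProductWith : ∀ {A B C : Set} (f : A → B → C) xs ys →
  length (cartesianProductWith f xs ys) ≡ length xs * length ys
length-cartesianProductWith f []       ys = ≡.refl
length-cartesianProductWith f (x ∷ xs) ys = ≡.trans (Listₚ.length-++ (map (f x) ys))
  (≡.cong₂ _+_ (Listₚ.length-map (f x) ys) (length-cartesianProductWith f xs ys))

-- Otherwise coordinates with respect to the basis of U would inject 𝔽₂^(m+1) into 𝔽₂^m.
∃-outside : ∀ {m} (U : Subspace (m + 1)) → HasDim U m → ∃[ z ] ¬ z ∈ U
∃-outside {m} U (us , basis) with ∃-dec (λ z → ¬? (Boolₚ.T? (Subspace.χ U z)))
... | yes found = found
... | no  ∄z    = ⊥-elim (ℕₚ.<⇒≱
  (ℕₚ.^-monoʳ-< 2 (s≤s (s≤s z≤n)) (ℕₚ.m<m+n m (s≤s z≤n)))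
  (injective⇒2^≤ (λ z → proj₁ (coords z)) λ {y} {z} eq →
    ≡.trans (≡.sym (proj₂ (coords y))) (≡.trans (≡.cong (λ as → linComb as us) eq) (proj₂ (coords z)))))
  where
  coords : ∀ z → ∃[ as ] linComb as us ≡ z
  coords z = IsBasis.spanning basis z
    (decidable-stable (Boolₚ.T? (Subspace.χ U z)) (λ z∉U → ∄z (z , z∉U)))

extend-independent : ∀ {n d} (U : Subspace n) {us : Vec (𝔽₂^ n) d} → IsBasis us U →
                     ∀ {z} → ¬ z ∈ U → LinearlyIndependent (z ∷ us)
extend-independent U {us} basis {z} z∉U (false ∷ as) eq =
  ≡.cong (false ∷_) (IsBasis.independent basis as (≡.trans (≡.sym (linComb-false as z us)) eq))
extend-independent U {us} basis {z} z∉U (true ∷ as) eq = ⊥-elim (z∉U (≡.subst (_∈ U)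
  (≡.sym (⊕≡𝟎⇒≡ (≡.trans (≡.sym (linComb-true as z us)) eq)))
  (linComb-closed U (IsBasis.members basis) as)))

-- The covering family and its size.

module Construction {k m h : ℕ} (k≤m : k ≤ m) (h≤1+m : h ≤ suc m) (e₁ : NonzeroVector k)
  (𝕊 : CoveringDesign h k 2)
  (U : Subspace h) (us : Vec (𝔽₂^ h) m) (us-basis : IsBasis us U)
  (z : 𝔽₂^ h) (z∉U : ¬ z ∈ U)
  (quadratics : InterpolatingFamily m)
  where

  open InterpolatingFamily quadratics using (at; interpolate) renaming (additive to at-⊕)

  lift : 𝔽₂^ m → 𝔽₂^ m → Embedding k (k + m)
  lift a b = graphEmbedding (at a b ∘ to (padEmbedding k≤m))
    (λ u v → ≡.trans (≡.cong (at a b) (additive (padEmbedding k≤m) u v)) (at-⊕ a b _ _))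

  lifted : List (Embedding k (k + m))
  lifted = cartesianProductWith lift (allVectors m) (allVectors m)

  length-lifted : length lifted ≡ 2 ^ (2 * m)
  length-lifted = begin
    length lifted
      ≡⟨ length-cartesianProductWith lift (allVectors m) (allVectors m) ⟩
    length (allVectors m) * length (allVectors m)
      ≡⟨ ≡.cong₂ _*_ (length-allVectors m) (length-allVectors m) ⟩
    2 ^ m * 2 ^ m ≡⟨ ℕₚ.^-distribˡ-+-* 2 m m ⟨
    2 ^ (m + m)
      ≡⟨ ≡.cong (λ j → 2 ^ (m + j)) (≡.sym (ℕₚ.+-identityʳ m)) ⟩
    2 ^ (2 * m)       ∎
    where open ≡.≡-Reasoning

  -- Padding preserves independence, so some map in the family sends the padded u to w and the
  -- padded v to x; its graph contains both vectors.
  lifted-covering : ∀ {u v} → IndependentPair u v → ∀ w x →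
                    Any (HitsPair (u Vec.++ w) (v Vec.++ x)) lifted
  lifted-covering {u} {v} (u≢𝟎 , v≢𝟎 , u≢v) w x =
    let a , b , eq , eq′ = interpolate (nonzero u≢𝟎) (nonzero v≢𝟎) (u≢v ∘ injective e) w x
    in  lose (∈ₚ.∈-cartesianProductWith⁺ lift (∈-allVectors a) (∈-allVectors b))
          ((u , ≡.cong (u Vec.++_) eq) , (v , ≡.cong (v Vec.++_) eq′))
    where
    e = padEmbedding k≤m
    nonzero : ∀ {u} → u ≢ 𝟎 → to e u ≢ 𝟎
    nonzero u≢𝟎 eq = u≢𝟎 (injective e (≡.trans eq (≡.sym (additive-𝟎 (to e) (additive e)))))

  -- Coordinates in which U becomes the hyperplane where the first coordinate is 0.
  frame : Embedding (suc m) h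
  frame = basisEmbedding (z ∷ us)
    (extend-independent U us-basis z∉U)

  unframe : Embedding h (suc m)
  unframe = inverseEmbedding h≤1+m frame

  unframe-frame : ∀ x → to unframe (to frame x) ≡ x
  unframe-frame = inverseEmbedding-section h≤1+m frame

  frame-true∉U : ∀ w → ¬ to frame (true ∷ w) ∈ U
  frame-true∉U w p = z∉U (≡.subst (_∈ U) (begin
    to frame (true ∷ w) ⊕ l ≡⟨ ≡.cong (_⊕ l) (linComb-true w z us) ⟩
    (z ⊕ l) ⊕ l             ≡⟨ ⊕-assoc z l l ⟩
    z ⊕ (l ⊕ l)             ≡⟨ ≡.cong (z ⊕_) (⊕-self l) ⟩
    z ⊕ 𝟎                   ≡⟨ ⊕-identityʳ z ⟩
    z                       ∎)
    (Subspace.⊕-closed U p (linComb-closed U (IsBasis.members us-basis) w)))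
    where
    open ≡.≡-Reasoning
    l = linComb w us

  copy : NonzeroVector k → ∀ {X} → HasDim X k → Embedding k (k + m)
  copy (u , u≢𝟎) (vs , basis) =
    lineEmbedding u u≢𝟎 ∘ᵉ unframe ∘ᵉ basisEmbedding vs (IsBasis.independent basis)

  -- The choice of `e₁` for blocks inside U is arbitrary: their copies lie in 0 × 𝔽₂ᵐ.
  copies : ∀ {Xs} → All (λ X → HasDim X k) Xs → List (Embedding k (k + m))
  copies []             = []
  copies (_∷_ {X} d ds) with X ⊆? U
  ... | yes _ = copy e₁ d ∷ copies ds
  ... | no  _ = map (λ u → copy u d) (nonzeroVectors k) ++ copies ds

  -- Here a = 2 ^ k - 2. A block inside U contributes 1 to the copies and a to the correction, any
  -- other block contributes a + 1 copies. The additive form avoids truncated subtraction.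
  length-copies : ∀ {a} → length (nonzeroVectors k) ≡ suc a →
    ∀ {Xs} (ds : All (λ X → HasDim X k) Xs) →
    length (copies ds) + a * length (filter (_⊆? U) Xs) ≡ suc a * length Xs
  length-copies {a} eq [] = ≡.trans (ℕₚ.*-zeroʳ a) (≡.sym (ℕₚ.*-zeroʳ (suc a)))
  length-copies {a} eq (_∷_ {X} {Xs} d ds) with X ⊆? U
  ... | yes _ = begin
    suc l + a * suc c       ≡⟨ solve 3 (λ l a c → con 1 :+ l :+ a :* (con 1 :+ c)
                                 := con 1 :+ a :+ (l :+ a :* c)) ≡.refl l a c ⟩
    suc a + (l + a * c)     ≡⟨ ≡.cong (suc a +_) (length-copies eq ds) ⟩
    suc a + suc a * length Xs ≡⟨ ℕₚ.*-suc (suc a) (length Xs) ⟨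
    suc a * suc (length Xs) ∎
    where
    open ≡.≡-Reasoning
    open +-*-Solver
    l = length (copies ds)
    c = length (filter (_⊆? U) Xs)
  ... | no _ = begin
    length (map (λ u → copy u d) (nonzeroVectors k) ++ copies ds) + a * c
      ≡⟨ ≡.cong (_+ a * c) (Listₚ.length-++ (map (λ u → copy u d) (nonzeroVectors k))) ⟩
    length (map (λ u → copy u d) (nonzeroVectors k)) + l + a * c
      ≡⟨ ≡.cong (λ j → j + l + a * c)
           (≡.trans (Listₚ.length-map (λ u → copy u d) (nonzeroVectors k)) eq) ⟩
    suc a + l + a * c       ≡⟨ ℕₚ.+-assoc (suc a) l (a * c) ⟩
    suc a + (l + a * c)     ≡⟨ ≡.cong (suc a +_) (length-copies eq ds) ⟩
    suc a + suc a * length Xs ≡⟨ ℕₚ.*-suc (suc a) (length Xs) ⟨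
    suc a * suc (length Xs) ∎
    where
    open ≡.≡-Reasoning
    l = length (copies ds)
    c = length (filter (_⊆? U) Xs)

  copy-hits : ∀ u {X} (d : HasDim X k) {s w} → to frame (s ∷ w) ∈ X →
              ∃[ as ] to (copy u d) as ≡ s · proj₁ u Vec.++ w
  copy-hits (u , u≢𝟎) (vs , basis) {s} {w} y∈X =
    let as , eq = IsBasis.spanning basis _ y∈X in
    as , ≡.cong (to (lineEmbedding u u≢𝟎)) (≡.trans (≡.cong (to unframe) eq) (unframe-frame (s ∷ w)))

  -- Inside U the framed first coordinate is 0, so the copies for all u coincide.
  copy-hits-inside : ∀ u {X} (d : HasDim X k) → X ⊆ U → ∀ v {s w} → to frame (s ∷ w) ∈ X →
                     ∃[ as ] to (copy u d) as ≡ s · v Vec.++ w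
  copy-hits-inside u d X⊆U v {true}  {w} y∈X = ⊥-elim (frame-true∉U w (X⊆U _ y∈X))
  copy-hits-inside u d X⊆U v {false} {w} y∈X =
    let as , eq = copy-hits u d y∈X in
    as , ≡.trans eq (≡.cong (Vec._++ w) (≡.trans (false· (proj₁ u)) (≡.sym (false· v))))

  copies-covering : ∀ {u} → u ≢ 𝟎 → ∀ {s w t x Xs} (ds : All (λ X → HasDim X k) Xs) →
    Any (λ X → to frame (s ∷ w) ∈ X × to frame (t ∷ x) ∈ X) Xs →
    Any (HitsPair (s · u Vec.++ w) (t · u Vec.++ x)) (copies ds)
  copies-covering {u} u≢𝟎 (_∷_ {X} d ds) p with X ⊆? U
  copies-covering {u} u≢𝟎 (d ∷ ds) (here (y∈ , z∈)) | yes X⊆U =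
    here (copy-hits-inside e₁ d X⊆U u y∈ , copy-hits-inside e₁ d X⊆U u z∈)
  copies-covering u≢𝟎 (d ∷ ds) (there p) | yes _ = there (copies-covering u≢𝟎 ds p)
  copies-covering {u} u≢𝟎 (d ∷ ds) (here (y∈ , z∈)) | no _ = Anyₚ.++⁺ˡ (Anyₚ.map⁺
    (Any.map (λ { {v} ≡.refl → copy-hits v d y∈ , copy-hits v d z∈ }) (∈-nonzeroVectors u u≢𝟎)))
  copies-covering u≢𝟎 (d ∷ ds) (there p) | no _ = Anyₚ.++⁺ʳ _ (copies-covering u≢𝟎 ds p)

  family : List (Embedding k (k + m))
  family = lifted ++ copies (dims 𝕊)

  family-covering : CoveringEmbeddings family
  family-covering y z pair with Vec.splitAt k y | Vec.splitAt k z
  ... | u , w , ≡.refl | v , x , ≡.refl with independent-or-collinear e₁ u v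
  ...   | inj₁ uv-pair = Anyₚ.++⁺ˡ (lifted-covering uv-pair w x)
  ...   | inj₂ (l , l≢𝟎 , s , t , ≡.refl , ≡.refl) = Anyₚ.++⁺ʳ lifted
    (copies-covering l≢𝟎 (dims 𝕊) (design-contains 𝕊 (framed-pair pair)))
    where
    line = lineEmbedding {m = m} l l≢𝟎
    line∘frame⁻ : ∀ {a} → to frame a ≡ 𝟎 → to line a ≡ 𝟎
    line∘frame⁻ {a} eq = ≡.trans
      (≡.cong (to line) (injective frame {a} {𝟎}
        (≡.trans eq (≡.sym (additive-𝟎 (to frame) (additive frame))))))
      (additive-𝟎 (to line) (additive line))
    -- A zero or a coincidence among the framed vectors pulls back along the injective `frame`, and
    -- `line` carries it to the original pair.
    framed-pair : IndependentPair (s · l Vec.++ w) (t · l Vec.++ x) →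
                  IndependentPair (to frame (s ∷ w)) (to frame (t ∷ x))
    framed-pair (y≢𝟎 , z≢𝟎 , y≢z) =
      y≢𝟎 ∘ line∘frame⁻ {s ∷ w} , z≢𝟎 ∘ line∘frame⁻ {t ∷ x} ,
      y≢z ∘ ≡.cong (to line) ∘ injective frame {s ∷ w} {t ∷ x}

  length-family : ∀ {a} → 2 ^ k ≡ suc (suc a) → length family ≡
    2 ^ (2 * m) + (2 ^ k ∸ 1) * ∣ 𝕊 ∣ ∸ (2 ^ k ∸ 2) * blocksInside 𝕊 U
  length-family {a} 2^k≡ = begin
    length family               ≡⟨ Listₚ.length-++ lifted ⟩
    length lifted + l           ≡⟨ ≡.cong (_+ l) length-lifted ⟩
    -- Adding `a * c` before subtracting it keeps the truncated subtraction exact and prepares for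
    -- `length-copies`.
    p + l                       ≡⟨ ℕₚ.m+n∸n≡m (p + l) (a * c) ⟨
    p + l + a * c ∸ a * c       ≡⟨ ≡.cong (_∸ a * c) (ℕₚ.+-assoc p l (a * c)) ⟩
    p + (l + a * c) ∸ a * c     ≡⟨ ≡.cong (λ j → p + j ∸ a * c) (length-copies
                                     (ℕₚ.suc-injective (≡.trans (length-nonzeroVectors k) 2^k≡))
                                     (dims 𝕊)) ⟩
    p + suc a * ∣ 𝕊 ∣ ∸ a * c   ≡⟨ ≡.cong (λ q → p + (q ∸ 1) * ∣ 𝕊 ∣ ∸ (q ∸ 2) * c) 2^k≡ ⟨
    p + (2 ^ k ∸ 1) * ∣ 𝕊 ∣ ∸ (2 ^ k ∸ 2) * c ∎
    where
    open ≡.≡-Reasoning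
    p = 2 ^ (2 * m)
    l = length (copies (dims 𝕊))
    c = blocksInside 𝕊 U

coveringNumber-bound : ∀ {n k m h} → n ≡ k + m → 1 ≤ k → k ≤ m → h ≤ suc m →
  (𝕊 : CoveringDesign h k 2) (U : Subspace h) → HasDim U m → (∃[ z ] ¬ z ∈ U) →
  ∃[ s ] (IsCoveringNumber n k 2 s ×
          s ≤ 2 ^ (2 * m) + (2 ^ k ∸ 1) * ∣ 𝕊 ∣ ∸ (2 ^ k ∸ 2) * blocksInside 𝕊 U)
coveringNumber-bound {k = suc k} {m = suc m} ≡.refl 1≤k k≤m h≤1+m 𝕊 U (us , basis) (z , z∉U) =
  let s , s-number , s≤ = coveringNumber (embeddings⇒bases family-covering)
  in  s , s-number , (begin
        s                                  ≤⟨ s≤ ⟩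
        length (map (images ∘ to) family)  ≡⟨ Listₚ.length-map (images ∘ to) family ⟩
        length family                      ≡⟨ length-family 2^k≡ ⟩
        _                                  ∎)
  where
  open ℕₚ.≤-Reasoning
  -- After matching, the field has 2 ^ (1 + m) elements, which is what index `m` produces; the first
  -- unit vector serves as the fixed nonzero vector.
  open Construction k≤m h≤1+m (true ∷ 𝟎 , λ ()) 𝕊 U us basis z z∉U (interpolatingFamily m)
  2^k≡ : 2 ^ suc k ≡ suc (suc (2 ^ suc k ∸ 2))
  2^k≡ = ≡.sym (ℕₚ.m+[n∸m]≡n (ℕₚ.^-monoʳ-≤ 2 1≤k))

mainTheorem10 : ∀ (n k : ℕ) → 2 * k ≤ n → 4 ≤ 2 * k →
    (𝕊 : CoveringDesign (n ∸ k + 1) k 2) →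
    (U : Subspace (n ∸ k + 1)) → HasDim U (n ∸ k) →
    let c = blocksInside 𝕊 U in
    ∃[ m ] (IsCoveringNumber n k 2 m ×
    m ≤ 2 ^ (2 * (n ∸ k)) + (2 ^ k ∸ 1) * ∣ 𝕊 ∣ ∸ (2 ^ k ∸ 2) * c)
mainTheorem10 n k 2k≤n 4≤2k 𝕊 U U-dim = coveringNumber-bound
  (≡.sym (ℕₚ.m+[n∸m]≡n (ℕₚ.≤-trans (ℕₚ.m≤m+n k _) 2k≤n)))
  (ℕₚ.≤-trans (s≤s z≤n) (ℕₚ.*-cancelˡ-≤ {2} 2 4≤2k))
  (ℕₚ.m+n≤o⇒m≤o∸n k (≡.subst (λ j → k + j ≤ n) (ℕₚ.+-identityʳ k) 2k≤n))
  (ℕₚ.≤-reflexive (ℕₚ.+-comm (n ∸ k) 1))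
  𝕊 U U-dim (∃-outside U U-dim)
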